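{- Let $\Gamma$ be a finite set of ground term equations over a signature $\Sigma$. Each $\sim_\Gamma$-congruence class of ground terms is infinite if and only if each constant of $\Sigma$ is of cyclic type. Thus, for a fixed $\Sigma$, the intrinsic infinity problem (given $\Gamma$, decide whether every $\sim_\Gamma$-congruence class is infinite) is decidable in time polynomial in $|\Gamma|$.
   Context: $\Sigma$ is a finite functional signature having function symbols (of positive arity) and constant symbols. $\mathcal{F}$ is the algebra of all ground terms (terms without variables) over $\Sigma$. A ground term equation is an expression $p=q$ with $p,q$ ground terms. For a finite set $\Gamma$ of such equations, $\sim_\Gamma$ is the smallest congruence on $\mathcal{F}$ containing all pairs $(p,q)$ with $p=q$ in $\Gamma$ (equivalently, $p\sim_\Gamma q$ iff $\Gamma\vdash p=q$). The size $|t|$ of a ground term is the number of nodes of its syntax tree, and $|\Gamma|=\sum_{(p=q)\in\Gamma}(|p|+|q|)$. Types. Let $V_\Gamma$ be the set of ground terms $p$ such that $p=q$ or $q=p$ is in $\Gamma$ for some $q$. Let $C_1,\dots,C_k$ be the distinct classes of $V_\Gamma$ under $\sim_\Gamma$. A ground term $t$ has type $i$ if $t\sim_\Gamma p$ for some $p\in C_i$; otherwise $t$ has no type. The graph $R_\Gamma$. Take the disjoint union, over $p\in V_\Gamma$, of the syntax trees of $p$, with directed edges from each node to its children. Each node thus represents a subterm of some $p\in V_\Gamma$; a node has type $i$ if the subterm it represents has type $i$, and is labelled $0$ if that subterm has no type. Add an undirected edge between every pair of distinct nodes having the same type $i>0$. The directed graph $\widehat{R_\Gamma}$ is the quotient of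 $R_\Gamma$ obtained by identifying nodes connected by an undirected edge (so all nodes of the same type $i>0$ are identified, and nodes labelled $0$ are not identified with any other node). There is a directed edge from $[v]$ to $[w]$ if there are $v'\in[v]$ and $w'\in[w]$ with a directed edge from $v'$ to $w'$ in $R_\Gamma$. A type $i$ is cyclic if some directed cycle of $\widehat{R_\Gamma}$ (self-loops count as cycles) is reachable by a directed path from the node of type $i$. A term is of cyclic type if it has a type and that type is cyclic. -}

module Defs where

open import Data.Fin using (Fin; toℕ)
open import Data.List using (List; []; _∷_; map; sum)
open import Data.List.Membership.Propositional using (_∈_; _∉_)
open import Data.Nat using (ℕ; zero; suc; _+_; _*_; _^_; _≤_; NonZero)
open import Data.Product using (_×_; _,_; ∃; ∃-syntax; proj₁; proj₂)
open import Data.Sum using (_⊎_)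
open import Data.Vec as Vec using (Vec; []; _∷_)
open import Data.Vec.Relation.Binary.Pointwise.Inductive using (Pointwise)
open import Function.Bundles using (_⇔_)
open import Relation.Binary.Construct.Closure.ReflexiveTransitive using (Star)
open import Relation.Binary.Construct.Closure.Transitive using (TransClosure)
open import Relation.Binary.PropositionalEquality using (_≢_)

record Signature : Set where
  field
    #constants : ℕ
    #functions : ℕ
    arity      : Fin #functions → ℕ
    arity>0    : ∀ f → NonZero (arity f)

-- Polynomial time.  The machine model is a first-order LISP: programs are
-- finite systems of mutually recursive unary functions on binary trees.  Every
-- evaluation step costs one unit.  Values are never mutated, so an implementation
-- passes trees by reference; each step then takes a bounded number of pointer
-- operations and allocates at most one cell.  Hence polynomial time here agrees
-- with polynomial time on Turing machines.

infixr 5 _∙_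

data Tree : Set where
  nil : Tree
  _∙_ : Tree → Tree → Tree

head tail : Tree → Tree
head nil     = nil
head (u ∙ v) = u
tail nil     = nil
tail (u ∙ v) = v

-- Expressions have a single variable `var`, the argument of the function being
-- evaluated.
data Expr (m : ℕ) : Set where
  var empty          : Expr m
  pair               : Expr m → Expr m → Expr m
  hd tl              : Expr m → Expr m
  if_then_else_      : Expr m → Expr m → Expr m → Expr m
  call               : Fin m → Expr m → Expr m

record Program : Set where
  field
    #procedures : ℕ
    body        : Fin #procedures → Expr #procedures
    main        : Expr #procedures

-- P ∣ x ⊢ e ⇓ v [ n ]: with `var` bound to x, e evaluates to v in n steps.
-- In conditionals nil is false and every other tree is true.
data _∣_⊢_⇓_[_] (P : Program) (x : Tree) :
       Expr (Program.#procedures P) → Tree → ℕ → Set where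
  ⇓var   : P ∣ x ⊢ var ⇓ x [ 1 ]
  ⇓empty : P ∣ x ⊢ empty ⇓ nil [ 1 ]
  ⇓pair  : ∀ {a b u v m n} →
           P ∣ x ⊢ a ⇓ u [ m ] → P ∣ x ⊢ b ⇓ v [ n ] →
           P ∣ x ⊢ pair a b ⇓ (u ∙ v) [ suc (m + n) ]
  ⇓hd    : ∀ {a u m} →
           P ∣ x ⊢ a ⇓ u [ m ] → P ∣ x ⊢ hd a ⇓ head u [ suc m ]
  ⇓tl    : ∀ {a u m} →
           P ∣ x ⊢ a ⇓ u [ m ] → P ∣ x ⊢ tl a ⇓ tail u [ suc m ]
  ⇓then  : ∀ {a b c u u′ v m n} →
           P ∣ x ⊢ a ⇓ (u ∙ u′) [ m ] → P ∣ x ⊢ b ⇓ v [ n ] →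
           P ∣ x ⊢ (if a then b else c) ⇓ v [ suc (m + n) ]
  ⇓else  : ∀ {a b c v m n} →
           P ∣ x ⊢ a ⇓ nil [ m ] → P ∣ x ⊢ c ⇓ v [ n ] →
           P ∣ x ⊢ (if a then b else c) ⇓ v [ suc (m + n) ]
  ⇓call  : ∀ {f a u v m n} →
           P ∣ x ⊢ a ⇓ u [ m ] → P ∣ u ⊢ Program.body P f ⇓ v [ n ] →
           P ∣ x ⊢ call f a ⇓ v [ suc (m + n) ]

-- One program and one polynomial c·nᵏ + c serve all instances; the program always
-- halts, and its answer is non-nil exactly on the instances satisfying Q.
PolynomialTimeDecidable : {A : Set} → (A → Tree) → (A → ℕ) → (A → Set) → Set
PolynomialTimeDecidable {A} encode size Q =
  ∃[ P ] ∃[ c ] ∃[ k ] ((a : A) →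
    ∃[ v ] ∃[ n ]
      (P ∣ encode a ⊢ Program.main P ⇓ v [ n ])
      × n ≤ c * size a ^ k + c
      × (v ≢ nil ⇔ Q a))

module _ (S : Signature) where
  open Signature S

  data Term : Set where
    con : Fin #constants → Term
    app : (f : Fin #functions) → Vec Term (arity f) → Term

  -- A finite set of equations is presented by a list of pairs.
  Equations : Set
  Equations = List (Term × Term)

module _ {S : Signature} where
  open Signature S

  ∣_∣ₜ : Term S → ℕ
  ∣_∣ₜ* : ∀ {n} → Vec (Term S) n → ℕ
  ∣ con c ∣ₜ    = 1
  ∣ app f ts ∣ₜ = suc ∣ ts ∣ₜ*
  ∣ [] ∣ₜ*      = 0
  ∣ t ∷ ts ∣ₜ*  = ∣ t ∣ₜ + ∣ ts ∣ₜ*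

  ∣_∣ᴱ : Equations S → ℕ
  ∣ Γ ∣ᴱ = sum (map (λ e → ∣ proj₁ e ∣ₜ + ∣ proj₂ e ∣ₜ) Γ)

  infix 4 _⊢_∼_

  data _⊢_∼_ (Γ : Equations S) : Term S → Term S → Set where
    axiom : ∀ {p q} → (p , q) ∈ Γ → Γ ⊢ p ∼ q
    refl  : ∀ {p} → Γ ⊢ p ∼ p
    sym   : ∀ {p q} → Γ ⊢ p ∼ q → Γ ⊢ q ∼ p
    trans : ∀ {p q r} → Γ ⊢ p ∼ q → Γ ⊢ q ∼ r → Γ ⊢ p ∼ r
    cong  : ∀ f {ps qs : Vec (Term S) (arity f)} →
            Pointwise (Γ ⊢_∼_) ps qs → Γ ⊢ app f ps ∼ app f qs

  Infinite : (Term S → Set) → Set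
  Infinite Q = (xs : List (Term S)) → ∃[ t ] Q t × t ∉ xs

  IntrinsicallyInfinite : Equations S → Set
  IntrinsicallyInfinite Γ = ∀ t → Infinite (λ s → Γ ⊢ s ∼ t)

  infix 4 _∈V_

  _∈V_ : Term S → Equations S → Set
  p ∈V Γ = ∃[ q ] ((p , q) ∈ Γ ⊎ (q , p) ∈ Γ)

  -- The types are the ∼-classes of V.  They are not numbered: a type is given by
  -- any representative p ∈V Γ, and p, p′ give the same type when Γ ⊢ p ∼ p′.
  HasType : Equations S → Term S → Term S → Set
  HasType Γ t p = p ∈V Γ × Γ ⊢ t ∼ p

  SameType : Equations S → Term S → Term S → Set
  SameType Γ s t = ∃[ p ] HasType Γ s p × HasType Γ t p

  -- The nodes of the syntax tree of a term.
  data Position : Term S → Set where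
    root  : ∀ {t} → Position t
    child : ∀ {f ts} (i : Fin (arity f)) →
            Position (Vec.lookup ts i) → Position (app f ts)

  subterm : (t : Term S) → Position t → Term S
  subterm t          root        = t
  subterm (app f ts) (child i π) = subterm (Vec.lookup ts i) π

  data _▷_ : ∀ {t} → Position t → Position t → Set where
    here  : ∀ {f ts} (i : Fin (arity f)) →
            root {app f ts} ▷ child i root
    there : ∀ {f ts} (i : Fin (arity f)) {π ρ : Position (Vec.lookup ts i)} →
            π ▷ ρ → child {f} {ts} i π ▷ child i ρ

  record Node (Γ : Equations S) : Set where
    constructor node
    field
      tree     : Term S
      tree∈V   : tree ∈V Γ
      position : Position tree

  ⟦_⟧ : ∀ {Γ} → Node Γ → Term S
  ⟦ node p _ π ⟧ = subterm p π

  -- V is a set of terms, so the proof that p ∈V Γ is no part of a node's identity.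
  data SameNode {Γ : Equations S} : Node Γ → Node Γ → Set where
    same : ∀ {p m m′ π} → SameNode (node p m π) (node p m′ π)

  -- The directed edges of R.
  data _⟶_ {Γ : Equations S} : Node Γ → Node Γ → Set where
    edge : ∀ {p m m′ π ρ} → π ▷ ρ → node p m π ⟶ node p m′ ρ

  -- The nodes of the quotient R̂ are those of R up to ≋.
  _≋_ : ∀ {Γ} → Node Γ → Node Γ → Set
  _≋_ {Γ} v w = SameNode v w ⊎ SameType Γ ⟦ v ⟧ ⟦ w ⟧

  -- The directed edges of R̂; since ⟶̂ respects ≋, paths and cycles of R̂ may be
  -- given through representatives.
  _⟶̂_ : ∀ {Γ} → Node Γ → Node Γ → Set
  v ⟶̂ w = ∃[ v′ ] ∃[ w′ ] v ≋ v′ × w ≋ w′ × v′ ⟶ w′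

  Cyclic : Equations S → Term S → Set
  Cyclic Γ p = ∃[ v ] ∃[ w ]
    HasType Γ ⟦ v ⟧ p × Star (_⟶̂_ {Γ}) v w × TransClosure _⟶̂_ w w

  HasCyclicType : Equations S → Term S → Set
  HasCyclicType Γ t = ∃[ p ] HasType Γ t p × Cyclic Γ p

  -- The input alphabet is fixed with S, so the encoding of Γ has size linear in
  -- ∣ Γ ∣ᴱ.  A symbol is a kind (nil for constants) paired with its index in unary;
  -- a term is its head symbol paired with the list of its arguments.
  unary : ℕ → Tree
  unary zero    = nil
  unary (suc n) = nil ∙ unary n

  encodeTerm : Term S → Tree
  encodeTerms : ∀ {n} → Vec (Term S) n → Tree
  encodeTerm (con c)    = (nil ∙ unary (toℕ c)) ∙ nil
  encodeTerm (app f ts) = ((nil ∙ nil) ∙ unary (toℕ f)) ∙ encodeTerms ts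
  encodeTerms []        = nil
  encodeTerms (t ∷ ts)  = encodeTerm t ∙ encodeTerms ts

  encode : Equations S → Tree
  encode []            = nil
  encode ((p , q) ∷ Γ) = (encodeTerm p ∙ encodeTerm q) ∙ encode Γ

{-# OPTIONS --safe #-}

-- A class is infinite iff it contains arbitrarily deep terms, and all classes are
-- infinite once those of the constants are, because a constant may be replaced inside
-- any term.  If s ∼ t, then s and t either have the same head symbol and congruent
-- arguments, or agree in this sense with two congruent members of V.  Hence descending
-- into a deep term congruent to c traces a walk in R̂, which must revisit a node once
-- it is longer than the number of nodes; conversely, going around a cycle of R̂ builds
-- deeper and deeper terms.
--
-- The decision procedure computes two least fixed points over the subtrees of its
-- input: the congruence closure E, and then the set F of terms with a finite class,
-- where s ∈ F as soon as all arguments of all terms E-related to s are in F.  Every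
-- class is infinite iff F contains no constant.  A fixed point over a universe of n
-- elements is reached after n rounds, so polynomial-time functions, with a polynomial
-- bound on the output size as well, suffice to assemble the program.

module Submission where

open import Defs
open import Algebra.Properties.CommutativeSemigroup using (x∙yz≈y∙xz)
open import Data.Empty using (⊥-elim)
open import Data.Fin as Fin using (Fin; zero; suc; toℕ; _↑ˡ_; _↑ʳ_; splitAt)
import Data.Fin.Properties as Fin
open import Data.List
  using (List; []; _∷_; _++_; map; length; lookup; allFin; concatMap; cartesianProductWith; filter; foldr)
import Data.List.Membership.DecPropositional as DecMembership
open import Data.List.Membership.Propositional using (_∈_; mapWith∈; lose)
open import Data.List.Membership.Propositional.Properties
  using (∈-++⁺ˡ; ∈-++⁺ʳ; ∈-allFin; ∈-cartesianProductWith⁺; ∈-concatMap⁺;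
         ∈-filter⁺; ∈-filter⁻; ∈-map⁺; ∈-map⁻)
open import Data.List.Properties using (length-filter)
open import Data.List.Relation.Binary.Subset.Propositional using (_⊆_)
open import Data.List.Relation.Unary.Any using (here; there; index)
import Data.List.Relation.Unary.Any.Properties as Any
open import Data.Nat using (ℕ; zero; suc; _+_; _*_; _^_; _⊔_; _≤_; _<_; z≤n; s≤s; NonZero)
open import Data.Nat.Properties
open import Data.Product using (_×_; _,_; ∃-syntax; proj₁; proj₂)
open import Data.Sum using (_⊎_; inj₁; inj₂; [_,_]′)
open import Data.Vec as Vec using (Vec; []; _∷_; _[_]≔_)
open import Data.Vec.Relation.Binary.Pointwise.Inductive as Pointwise using (Pointwise; []; _∷_)
open import Data.Vec.Relation.Unary.All using (All; []; _∷_)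
open import Function using (_∘_; id)
open import Function.Bundles using (_⇔_; mk⇔; Equivalence)
open import Relation.Binary.Construct.Closure.ReflexiveTransitive using (Star; ε; _◅_)
open import Relation.Binary.Construct.Closure.Transitive using (TransClosure; [_]; _∷_)
import Relation.Binary.PropositionalEquality as ≡
open ≡ using (_≡_; _≢_; refl; cong₂; subst)
open import Relation.Nullary using (¬_; Dec; yes; no)
open import Relation.Nullary.Decidable using (decidable-stable)

-- Depth

module _ {S : Signature} where
  open Signature S

  depth : Term S → ℕ
  depths : ∀ {n} → Vec (Term S) n → ℕ
  depth (con c)    = 0
  depth (app f ts) = suc (depths ts)
  depths []        = 0
  depths (t ∷ ts)  = depth t ⊔ depths ts

  vectors : List (Term S) → ∀ n → List (Vec (Term S) n)
  vectors ts zero    = [] ∷ []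
  vectors ts (suc n) = cartesianProductWith _∷_ ts (vectors ts n)

  terms≤ : ℕ → List (Term S)
  terms≤ zero    = map con (allFin _)
  terms≤ (suc k) = map con (allFin _) ++ concatMap (λ f → map (app f) (vectors (terms≤ k) (arity f))) (allFin _)

  -- A finite signature has only finitely many terms of each depth, so a class that leaves every
  -- finite list leaves this one and contains a term deeper than `k`.
  ∈-terms≤ : ∀ {k} t → depth t ≤ k → t ∈ terms≤ k
  ∈-vectors : ∀ {k n} (ts : Vec (Term S) n) → depths ts ≤ k → ts ∈ vectors (terms≤ k) n
  ∈-terms≤ {zero}  (con c)    _         = ∈-map⁺ con (∈-allFin c)
  ∈-terms≤ {suc k} (con c)    _         = ∈-++⁺ˡ (∈-map⁺ con (∈-allFin c))
  ∈-terms≤ {suc k} (app f ts) (s≤s ts≤) =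
    ∈-++⁺ʳ _ (∈-concatMap⁺ _ (lose (∈-allFin f) (∈-map⁺ (app f) (∈-vectors ts ts≤))))
  ∈-vectors []       _   = here refl
  ∈-vectors (t ∷ ts) ts≤ =
    ∈-cartesianProductWith⁺ _∷_ (∈-terms≤ t (≤-trans (m≤m⊔n _ _) ts≤)) (∈-vectors ts (≤-trans (m≤n⊔m _ _) ts≤))

  -- Needs positive arity: an empty vector has `depths` 0 but no index to return.
  deepest : ∀ {n} .{{_ : NonZero n}} (ts : Vec (Term S) n) → ∃[ i ] depths ts ≤ depth (Vec.lookup ts i)
  deepest (t ∷ []) = zero , ≤-reflexive (⊔-identityʳ _)
  deepest (t ∷ s ∷ ts) with ⊔-sel (depth t) (depths (s ∷ ts)) | deepest (s ∷ ts)
  ... | inj₁ max≡t  | _      = zero , ≤-reflexive max≡t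
  ... | inj₂ max≡ts | i , ≤i = suc i , ≤-trans (≤-reflexive max≡ts) ≤i

  depth-[]≔ : ∀ {n} (ts : Vec (Term S) n) i s → depth s ≤ depths (ts [ i ]≔ s)
  depth-[]≔ (t ∷ ts) zero    s = m≤m⊔n _ _
  depth-[]≔ (t ∷ ts) (suc i) s = ≤-trans (depth-[]≔ ts i s) (m≤n⊔m _ _)

  -- The child relation on terms instead of positions, so that it can be transported along
  -- congruences.
  data _⊳_ : Term S → Term S → Set where
    arg : ∀ f ts i → app f ts ⊳ Vec.lookup ts i

  ▷⇒⊳ : ∀ {t} {π ρ : Position t} → π ▷ ρ → subterm t π ⊳ subterm t ρ
  ▷⇒⊳ (here i)      = arg _ _ i
  ▷⇒⊳ (there i π▷ρ) = ▷⇒⊳ π▷ρ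

  ⊳⇒▷ : ∀ {t s} (π : Position t) → subterm t π ⊳ s → ∃[ ρ ] π ▷ ρ × subterm t ρ ≡ s
  ⊳⇒▷ root        (arg f ts i) = child i root , here i , refl
  ⊳⇒▷ (child i π) π⊳s          =
    let ρ , π▷ρ , ρ≡s = ⊳⇒▷ π π⊳s in child i ρ , there i π▷ρ , ρ≡s

  positions : ∀ t → List (Position t)
  -- Recursion over the vector makes the descent structural, which recursion on `Vec.lookup ts i`
  -- would not be.
  argPositions : ∀ {n} (ts : Vec (Term S) n) i → List (Position (Vec.lookup ts i))
  positions (con c)    = root ∷ []
  positions (app f ts) = root ∷ concatMap (λ i → map (child i) (argPositions ts i)) (allFin _)
  argPositions (t ∷ ts) zero    = positions t
  argPositions (t ∷ ts) (suc i) = argPositions ts i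

  ∈-positions : ∀ t (π : Position t) → π ∈ positions t
  ∈-argPositions : ∀ {n} (ts : Vec (Term S) n) i π → π ∈ argPositions ts i
  ∈-positions (con c)    root        = here refl
  ∈-positions (app f ts) root        = here refl
  ∈-positions (app f ts) (child i π) =
    there (∈-concatMap⁺ _ (lose (∈-allFin i) (∈-map⁺ (child i) (∈-argPositions ts i π))))
  ∈-argPositions (t ∷ ts) zero    π = ∈-positions t π
  ∈-argPositions (t ∷ ts) (suc i) π = ∈-argPositions ts i π

-- Congruence at the root of a term.

module _ {S : Signature} (Γ : Equations S) where
  open Signature S

  ∼*-refl : ∀ {n} {ts : Vec (Term S) n} → Pointwise (Γ ⊢_∼_) ts ts
  ∼*-refl = Pointwise.refl refl

  []≔-∼ : ∀ {n} (ts : Vec (Term S) n) i {s} → Γ ⊢ s ∼ Vec.lookup ts i → Pointwise (Γ ⊢_∼_) (ts [ i ]≔ s) ts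
  []≔-∼ (t ∷ ts) zero    s∼t = s∼t ∷ ∼*-refl
  []≔-∼ (t ∷ ts) (suc i) s∼t = refl ∷ []≔-∼ ts i s∼t

  -- Rewriting below the root only: the head symbol stays fixed.
  data _≈ʳ_ : Term S → Term S → Set where
    con : ∀ {c} → con c ≈ʳ con c
    app : ∀ {f ps qs} → Pointwise (Γ ⊢_∼_) ps qs → app f ps ≈ʳ app f qs

  ≈ʳ-refl : ∀ {t} → t ≈ʳ t
  ≈ʳ-refl {con c}    = con
  ≈ʳ-refl {app f ts} = app ∼*-refl

  ≈ʳ-sym : ∀ {s t} → s ≈ʳ t → t ≈ʳ s
  ≈ʳ-sym con        = con
  ≈ʳ-sym (app ps∼qs) = app (Pointwise.sym sym ps∼qs)

  ≈ʳ-trans : ∀ {s t u} → s ≈ʳ t → t ≈ʳ u → s ≈ʳ u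
  ≈ʳ-trans con         con         = con
  ≈ʳ-trans (app ps∼qs) (app qs∼rs) = app (Pointwise.trans trans ps∼qs qs∼rs)

  ≈ʳ⇒∼ : ∀ {s t} → s ≈ʳ t → Γ ⊢ s ∼ t
  ≈ʳ⇒∼ con         = refl
  ≈ʳ⇒∼ (app ps∼qs) = cong _ ps∼qs

  data _≈ᵛ_ (s t : Term S) : Set where
    viaV : ∀ {p q} → p ∈V Γ → q ∈V Γ → s ≈ʳ p → Γ ⊢ p ∼ q → q ≈ʳ t → s ≈ᵛ t

  -- Induction on the derivation. Only axioms act at the root, and they lead from `V` to `V`. Under
  -- transitivity two passages through `V` merge into one, since the stretch between them is itself
  -- a congruence of two members of `V`.
  ∼⇒≈ʳ⊎≈ᵛ : ∀ {s t} → Γ ⊢ s ∼ t → s ≈ʳ t ⊎ s ≈ᵛ t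
  ∼⇒≈ʳ⊎≈ᵛ (axiom pq∈)    = inj₂ (viaV (_ , inj₁ pq∈) (_ , inj₂ pq∈) ≈ʳ-refl (axiom pq∈) ≈ʳ-refl)
  ∼⇒≈ʳ⊎≈ᵛ refl           = inj₁ ≈ʳ-refl
  ∼⇒≈ʳ⊎≈ᵛ (sym t∼s)      with ∼⇒≈ʳ⊎≈ᵛ t∼s
  ... | inj₁ t≈s                  = inj₁ (≈ʳ-sym t≈s)
  ... | inj₂ (viaV p∈ q∈ a p∼q b) = inj₂ (viaV q∈ p∈ (≈ʳ-sym b) (sym p∼q) (≈ʳ-sym a))
  ∼⇒≈ʳ⊎≈ᵛ (trans s∼t t∼u) with ∼⇒≈ʳ⊎≈ᵛ s∼t | ∼⇒≈ʳ⊎≈ᵛ t∼u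
  ... | inj₁ s≈t                  | inj₁ t≈u                   = inj₁ (≈ʳ-trans s≈t t≈u)
  ... | inj₁ s≈t                  | inj₂ (viaV p∈ q∈ a p∼q b)  = inj₂ (viaV p∈ q∈ (≈ʳ-trans s≈t a) p∼q b)
  ... | inj₂ (viaV p∈ q∈ a p∼q b) | inj₁ t≈u                   = inj₂ (viaV p∈ q∈ a p∼q (≈ʳ-trans b t≈u))
  ... | inj₂ (viaV p∈ _ a p∼q b)  | inj₂ (viaV _ q∈ a′ p∼q′ b′) =
    inj₂ (viaV p∈ q∈ a (trans p∼q (trans (≈ʳ⇒∼ (≈ʳ-trans b a′)) p∼q′)) b′)
  ∼⇒≈ʳ⊎≈ᵛ (cong f ps∼qs) = inj₁ (app ps∼qs)

  -- Classes of unbounded depth.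

  Deep : ℕ → Term S → Set
  Deep k t = ∃[ s ] Γ ⊢ s ∼ t × k ≤ depth s

  Unbounded : Term S → Set
  Unbounded t = ∀ k → Deep k t

  Deep-≤ : ∀ {k l t} → k ≤ l → Deep l t → Deep k t
  Deep-≤ k≤l (s , s∼t , l≤s) = s , s∼t , ≤-trans k≤l l≤s

  Deep-∼ : ∀ {k s t} → Γ ⊢ s ∼ t → Deep k s → Deep k t
  Deep-∼ s∼t (r , r∼s , k≤r) = r , trans r∼s s∼t , k≤r

  Deep-⊳ : ∀ {k s t} → t ⊳ s → Deep k s → Deep (suc k) t
  Deep-⊳ (arg f ts i) (s , s∼tsᵢ , k≤s) =
    app f (ts [ i ]≔ s) , cong f ([]≔-∼ ts i s∼tsᵢ) , s≤s (≤-trans k≤s (depth-[]≔ ts i s))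

  -- As arities are positive, following first arguments always ends in a constant; deepening this
  -- leaf deepens the whole term.
  Unbounded-con⇒Unbounded : (∀ c → Unbounded (con c)) → ∀ t → Unbounded t
  Unbounded-con⇒Unbounded* : (∀ c → Unbounded (con c)) →
    ∀ {n} .{{_ : NonZero n}} (ts : Vec (Term S) n) → ∃[ i ] Unbounded (Vec.lookup ts i)
  Unbounded-con⇒Unbounded con-unbounded (con c)    = con-unbounded c
  Unbounded-con⇒Unbounded con-unbounded (app f ts) k =
    let i , unbounded = Unbounded-con⇒Unbounded* con-unbounded {{arity>0 f}} ts
    in  Deep-≤ (n≤1+n k) (Deep-⊳ (arg f ts i) (unbounded k))
  Unbounded-con⇒Unbounded* con-unbounded (t ∷ ts) =
    zero , Unbounded-con⇒Unbounded con-unbounded t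

  maxDepth : List (Term S) → ℕ
  maxDepth = foldr (λ t → depth t ⊔_) 0

  depth≤maxDepth : ∀ {t ts} → t ∈ ts → depth t ≤ maxDepth ts
  depth≤maxDepth (here refl) = m≤m⊔n _ _
  depth≤maxDepth (there t∈)  = ≤-trans (depth≤maxDepth t∈) (m≤n⊔m _ _)

  -- The terms of bounded depth form a finite list, and conversely the members of a finite list have
  -- bounded depth.
  IntrinsicallyInfinite⇔Unbounded : IntrinsicallyInfinite Γ ⇔ (∀ c → Unbounded (con c))
  IntrinsicallyInfinite⇔Unbounded = mk⇔ to from
    where
    to : IntrinsicallyInfinite Γ → ∀ c → Unbounded (con c)
    to infinite c k with infinite (con c) (terms≤ k)
    ... | t , t∼c , t∉ = t , t∼c , <⇒≤ (≰⇒> (t∉ ∘ ∈-terms≤ t))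
    from : (∀ c → Unbounded (con c)) → IntrinsicallyInfinite Γ
    from con-unbounded t ts with Unbounded-con⇒Unbounded con-unbounded t (suc (maxDepth ts))
    ... | s , s∼t , ts<s = s , s∼t , <⇒≱ ts<s ∘ depth≤maxDepth

  -- From cycles of the quotient graph to deep terms.

  ≋⇒∼ : ∀ {v w : Node Γ} → v ≋ w → Γ ⊢ ⟦ v ⟧ ∼ ⟦ w ⟧
  ≋⇒∼ (inj₁ same)                           = refl
  ≋⇒∼ (inj₂ (_ , (_ , v∼p) , (_ , w∼p))) = trans v∼p (sym w∼p)

  -- Up to congruence the target is an argument of the source, so replacing that argument by a deep
  -- term gains one level.
  Deep-⟶̂ : ∀ {k} {v w : Node Γ} → v ⟶̂ w → Deep k ⟦ w ⟧ → Deep (suc k) ⟦ v ⟧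
  Deep-⟶̂ (_ , _ , v≋v′ , w≋w′ , edge π▷ρ) =
    Deep-∼ (sym (≋⇒∼ v≋v′)) ∘ Deep-⊳ (▷⇒⊳ π▷ρ) ∘ Deep-∼ (≋⇒∼ w≋w′)

  Deep-⟶̂⁺ : ∀ {k} {v w : Node Γ} → TransClosure _⟶̂_ v w → Deep k ⟦ w ⟧ → Deep (suc k) ⟦ v ⟧
  Deep-⟶̂⁺ [ v⟶w ]      deep = Deep-⟶̂ v⟶w deep
  Deep-⟶̂⁺ (v⟶u ∷ u⟶⁺w) deep = Deep-⟶̂ v⟶u (Deep-≤ (n≤1+n _) (Deep-⟶̂⁺ u⟶⁺w deep))

  Deep-⟶̂* : ∀ {k} {v w : Node Γ} → Star _⟶̂_ v w → Deep k ⟦ w ⟧ → Deep k ⟦ v ⟧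
  Deep-⟶̂* ε            deep = deep
  Deep-⟶̂* (v⟶u ◅ u⟶*w) deep = Deep-≤ (n≤1+n _) (Deep-⟶̂ v⟶u (Deep-⟶̂* u⟶*w deep))

  -- Each turn around the cycle adds at least one level.
  cycle⇒Unbounded : ∀ {w : Node Γ} → TransClosure _⟶̂_ w w → Unbounded ⟦ w ⟧
  cycle⇒Unbounded w⟶⁺w zero    = _ , refl , z≤n
  cycle⇒Unbounded w⟶⁺w (suc k) = Deep-⟶̂⁺ w⟶⁺w (cycle⇒Unbounded w⟶⁺w k)

  HasCyclicType⇒Unbounded : ∀ {t} → HasCyclicType Γ t → Unbounded t
  HasCyclicType⇒Unbounded (p , (_ , t∼p) , _ , _ , (_ , v∼p) , v⟶*w , w⟶⁺w) k =
    Deep-∼ (trans v∼p (sym t∼p)) (Deep-⟶̂* v⟶*w (cycle⇒Unbounded w⟶⁺w k))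

  -- From deep terms to cycles of the quotient graph.

  treesOfV : List (∃[ p ] p ∈V Γ)
  treesOfV = mapWith∈ Γ (λ {e} e∈ → proj₁ e , proj₂ e , inj₁ e∈)
          ++ mapWith∈ Γ (λ {e} e∈ → proj₂ e , proj₁ e , inj₂ e∈)

  ∈-treesOfV : ∀ {p} → p ∈V Γ → ∃[ p∈ ] (p , p∈) ∈ treesOfV
  ∈-treesOfV (q , inj₁ pq∈) = _ , ∈-++⁺ˡ (Any.mapWith∈⁺ _ (_ , pq∈ , refl))
  ∈-treesOfV (q , inj₂ qp∈) = _ , ∈-++⁺ʳ _ (Any.mapWith∈⁺ _ (_ , qp∈ , refl))

  -- A tree is listed once for each of its occurrences as a side of an equation, and nodes of equal
  -- type are not merged. The pigeonhole argument needs only a finite list.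
  nodes : List (Node Γ)
  nodes = concatMap (λ (p , p∈) → map (node p p∈) (positions p)) treesOfV

  ∈-nodes : ∀ {p p∈} → (p , p∈) ∈ treesOfV → ∀ π → node p p∈ π ∈ nodes
  ∈-nodes p∈trees π = ∈-concatMap⁺ _ (lose p∈trees (∈-map⁺ (node _ _) (∈-positions _ π)))

  data Walk : Node Γ → ℕ → Set where
    stop : ∀ {v} → v ∈ nodes → Walk v 0
    step : ∀ {v w k} → v ∈ nodes → v ⟶̂ w → Walk w k → Walk v (suc k)

  at : ∀ {v k} → Walk v k → Fin (suc k) → Node Γ
  at {v} _            zero    = v
  at     (step _ _ W) (suc i) = at W i

  at∈ : ∀ {v k} (W : Walk v k) i → at W i ∈ nodes
  at∈ (stop v∈)     zero    = v∈
  at∈ (step v∈ _ W) zero    = v∈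
  at∈ (step _ _ W)  (suc i) = at∈ W i

  at-reachable : ∀ {v k} (W : Walk v k) i → Star _⟶̂_ v (at W i)
  at-reachable W               zero    = ε
  at-reachable (step _ v⟶w W) (suc i) = v⟶w ◅ at-reachable W i

  at-path : ∀ {v k} (W : Walk v k) {i j} → i Fin.< j → TransClosure _⟶̂_ (at W i) (at W j)
  at-path (step _ v⟶w W) {zero}  {suc j} _         = prepend v⟶w (at-reachable W j)
    where
    prepend : ∀ {u v w : Node Γ} → u ⟶̂ v → Star _⟶̂_ v w → TransClosure _⟶̂_ u w
    prepend u⟶v ε            = [ u⟶v ]
    prepend u⟶v (v⟶w ◅ w⟶*x) = u⟶v ∷ prepend v⟶w w⟶*x
  at-path (step _ _ W)    {suc i} {suc j} (s≤s i<j) = at-path W i<j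

  -- The walk visits one node more than the list has entries, so two visits share an index; they are
  -- then the same node, and the stretch between them is a cycle.
  Walk⇒cycle : ∀ {v} → Walk v (length nodes) → ∃[ w ] Star _⟶̂_ v w × TransClosure _⟶̂_ w w
  Walk⇒cycle W with Fin.pigeonhole (n<1+n _) (λ i → index (at∈ W i))
  ... | i , j , i<j , same-index =
    at W i , at-reachable W i ,
    subst (TransClosure _⟶̂_ (at W i)) (≡.sym at-i≡at-j) (at-path W i<j)
    where
    at-i≡at-j : at W i ≡ at W j
    at-i≡at-j = ≡.trans (Any.lookup-index (at∈ W i))
                        (≡.trans (≡.cong (lookup nodes) same-index) (≡.sym (Any.lookup-index (at∈ W j))))

  -- The state of the descent: the node need only be congruent to the current term. The field
  -- `tree∈` keeps the walk inside the finite list `nodes`.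
  record Represents (v : Node Γ) (t : Term S) : Set where
    constructor represents
    field
      tree∈  : (Node.tree v , Node.tree∈V v) ∈ treesOfV
      t∼⟦v⟧  : Γ ⊢ t ∼ ⟦ v ⟧

  ≈ʳ-⊳ : ∀ {s s′ t} → s ≈ʳ t → s ⊳ s′ → ∃[ t′ ] t ⊳ t′ × Γ ⊢ s′ ∼ t′
  ≈ʳ-⊳ (app ps∼qs) (arg f ps i) = _ , arg f _ i , Pointwise.lookup ps∼qs i

  -- If `s` agrees with the term of `v` at the root, the step stays in the tree of `v`. Otherwise it
  -- goes through the root of some `q` in `V`, which has the type of `v` and hence is the same node
  -- of the quotient.
  Represents-⊳ : ∀ {v s t} → Represents v s → s ⊳ t → ∃[ w ] v ⟶̂ w × Represents w t
  Represents-⊳ {node p p∈ π} {s} (represents tree∈ s∼v) s⊳t with ∼⇒≈ʳ⊎≈ᵛ s∼v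
  ... | inj₁ s≈v =
    let t′ , v⊳t′ , t∼t′ = ≈ʳ-⊳ s≈v s⊳t
        ρ , π▷ρ , ρ≡t′   = ⊳⇒▷ π v⊳t′
    in  node p p∈ ρ , (_ , _ , inj₁ same , inj₁ same , edge {m = p∈} {m′ = p∈} π▷ρ) ,
        represents tree∈ (subst (Γ ⊢ _ ∼_) (≡.sym ρ≡t′) t∼t′)
  ... | inj₂ (viaV {q} {r} q∈ r∈ s≈q q∼r r≈v) =
    let q∈′ , tree∈′     = ∈-treesOfV q∈
        t′ , q⊳t′ , t∼t′ = ≈ʳ-⊳ s≈q s⊳t
        ρ , π▷ρ , ρ≡t′   = ⊳⇒▷ (root {t = q}) q⊳t′
        v∼r              = sym (≈ʳ⇒∼ r≈v)
    in  node q q∈′ ρ ,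
        (node q q∈′ root , node q q∈′ ρ , inj₂ (r , (r∈ , v∼r) , (r∈ , q∼r)) , inj₁ same , edge π▷ρ) ,
        represents tree∈′ (subst (Γ ⊢ _ ∼_) (≡.sym ρ≡t′) t∼t′)

  Represents⇒Walk : ∀ {v t} k → Represents v t → k ≤ depth t → Walk v k
  Represents⇒Walk {v} zero rep _ = stop (∈-nodes (Represents.tree∈ rep) _)
  Represents⇒Walk {v} {app f ts} (suc k) rep (s≤s k≤) =
    let i , ts≤        = deepest {{arity>0 f}} ts
        w , v⟶w , rep′ = Represents-⊳ rep (arg f ts i)
    in  step (∈-nodes (Represents.tree∈ rep) _) v⟶w (Represents⇒Walk k rep′ (≤-trans k≤ ts≤))

  Unbounded⇒HasCyclicType : ∀ c → Unbounded (con c) → HasCyclicType Γ (con c)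
  -- The extra level excludes `t` being the constant itself, even when `nodes` is empty.
  Unbounded⇒HasCyclicType c unbounded with unbounded (suc (length nodes))
  ... | t , t∼c , nodes<t with ∼⇒≈ʳ⊎≈ᵛ t∼c
  ...   | inj₁ con = ⊥-elim (n≮0 nodes<t)
  -- Only the constant itself agrees with `con c` at the root, so `con c` lies in `V`.
  ...   | inj₂ (viaV _ c∈ _ _ con) =
    let c∈′ , tree∈       = ∈-treesOfV c∈
        v                 = node (con c) c∈′ root
        walk              = Represents⇒Walk {v} _ (represents tree∈ t∼c) (<⇒≤ nodes<t)
        w , v⟶*w , w⟶⁺w = Walk⇒cycle walk
    in  con c , (c∈ , refl) , v , w , (c∈ , refl) , v⟶*w , w⟶⁺w

  IntrinsicallyInfinite⇔HasCyclicType : IntrinsicallyInfinite Γ ⇔ (∀ c → HasCyclicType Γ (con c))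
  IntrinsicallyInfinite⇔HasCyclicType = mk⇔
    (λ infinite c → Unbounded⇒HasCyclicType c (Equivalence.to IntrinsicallyInfinite⇔Unbounded infinite c))
    (λ cyclic → Equivalence.from IntrinsicallyInfinite⇔Unbounded (λ c → HasCyclicType⇒Unbounded (cyclic c)))

-- Polynomials

infixl 6 _⊕_
infixl 7 _⊗_
infixr 9 _∘ₚ_

data Polynomial : Set where
  const   : ℕ → Polynomial
  X       : Polynomial
  _⊕_ _⊗_ : Polynomial → Polynomial → Polynomial

eval : Polynomial → ℕ → ℕ
eval (const c) n = c
eval X         n = n
eval (p ⊕ q)   n = eval p n + eval q n
eval (p ⊗ q)   n = eval p n * eval q n

eval-mono : ∀ p {m n} → m ≤ n → eval p m ≤ eval p n
eval-mono (const c) m≤n = ≤-refl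
eval-mono X         m≤n = m≤n
eval-mono (p ⊕ q)   m≤n = +-mono-≤ (eval-mono p m≤n) (eval-mono q m≤n)
eval-mono (p ⊗ q)   m≤n = *-mono-≤ (eval-mono p m≤n) (eval-mono q m≤n)

_∘ₚ_ : Polynomial → Polynomial → Polynomial
const c ∘ₚ r = const c
X       ∘ₚ r = r
(p ⊕ q) ∘ₚ r = (p ∘ₚ r) ⊕ (q ∘ₚ r)
(p ⊗ q) ∘ₚ r = (p ∘ₚ r) ⊗ (q ∘ₚ r)

eval-∘ₚ : ∀ p r n → eval (p ∘ₚ r) n ≡ eval p (eval r n)
eval-∘ₚ (const c) r n = refl
eval-∘ₚ X         r n = refl
eval-∘ₚ (p ⊕ q)   r n = cong₂ _+_ (eval-∘ₚ p r n) (eval-∘ₚ q r n)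
eval-∘ₚ (p ⊗ q)   r n = cong₂ _*_ (eval-∘ₚ p r n) (eval-∘ₚ q r n)

-- The factor 2 is for `n = 0`, where powers are not monotone in the exponent: the zeroth power is 1
-- and all others are 0.
1+n^-≤ : ∀ n k l → suc (n ^ k) ≤ 2 * suc (n ^ (k + l))
1+n^-≤ zero zero l    = *-monoʳ-≤ 2 {1} {suc (0 ^ l)} (s≤s z≤n)
1+n^-≤ zero (suc k) l = s≤s z≤n
1+n^-≤ n@(suc _) k l  =
  ≤-trans (s≤s (^-monoʳ-≤ n (m≤m+n k l))) (m≤m+n _ _)

1+n^-*-≤ : ∀ n k l → suc (n ^ k) * suc (n ^ l) ≤ 4 * suc (n ^ (k + l))
1+n^-*-≤ zero zero l = begin
  2 * suc (0 ^ l)             ≤⟨ *-monoˡ-≤ (suc (0 ^ l)) {2} {4} (s≤s (s≤s z≤n)) ⟩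
  4 * suc (0 ^ l)             ∎
  where open ≤-Reasoning
1+n^-*-≤ zero (suc k) l = begin
  suc (0 ^ l) + 0 ≡⟨ +-identityʳ _ ⟩
  suc (0 ^ l)     ≤⟨ s≤s (0^≤1 l) ⟩
  2               ≤⟨ s≤s (s≤s z≤n) ⟩
  4               ∎
  where
  open ≤-Reasoning
  0^≤1 : ∀ l → 0 ^ l ≤ 1
  0^≤1 zero    = ≤-refl
  0^≤1 (suc l) = z≤n
1+n^-*-≤ n@(suc _) k l = begin
  suc (n ^ k) * suc (n ^ l)             ≤⟨ *-mono-≤ (1+≤2* k) (1+≤2* l) ⟩
  (2 * n ^ k) * (2 * n ^ l)             ≡⟨ [m*n]*[o*p]≡[m*o]*[n*p] 2 (n ^ k) 2 (n ^ l) ⟩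
  4 * (n ^ k * n ^ l)                   ≡⟨ ≡.cong (4 *_) (≡.sym (^-distribˡ-+-* n k l)) ⟩
  4 * n ^ (k + l)                       ≤⟨ *-monoʳ-≤ 4 (n≤1+n _) ⟩
  4 * suc (n ^ (k + l))                 ∎
  where
  open ≤-Reasoning
  1+≤2* : ∀ k → suc (n ^ k) ≤ 2 * n ^ k
  1+≤2* k = +-mono-≤ (m^n>0 n k) (≤-reflexive (≡.sym (+-identityʳ _)))

-- The bound has the form `c * n ^ k + c` required of a polynomial running time, with the two
-- summands kept together as a product for the induction.
eval-≤ : ∀ p → ∃[ c ] ∃[ k ] ∀ n → eval p n ≤ c * suc (n ^ k)
eval-≤ (const c) = c , 0 , λ n → m≤m*n c 2
eval-≤ X         = 1 , 1 , λ n →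
  ≤-trans (n≤1+n n) (≤-reflexive (≡.sym (≡.trans (+-identityʳ _) (≡.cong suc (*-identityʳ n)))))
eval-≤ (p ⊕ q) with eval-≤ p | eval-≤ q
... | c , k , p≤ | d , l , q≤ = c * 2 + d * 2 , k + l , λ n → begin
  eval p n + eval q n                                 ≤⟨ +-mono-≤ (p≤ n) (q≤ n) ⟩
  c * suc (n ^ k) + d * suc (n ^ l)                   ≤⟨ +-mono-≤ (*-monoʳ-≤ c (1+n^-≤ n k l))
               (*-monoʳ-≤ d (subst (λ m → suc (n ^ l) ≤ 2 * suc (n ^ m)) (+-comm l k) (1+n^-≤ n l k))) ⟩
  c * (2 * m n) + d * (2 * m n)
    ≡⟨ cong₂ _+_ (≡.sym (*-assoc c 2 (m n))) (≡.sym (*-assoc d 2 (m n))) ⟩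
  c * 2 * m n + d * 2 * m n                           ≡⟨ ≡.sym (*-distribʳ-+ (m n) (c * 2) (d * 2)) ⟩
  (c * 2 + d * 2) * m n                               ∎
  where
  open ≤-Reasoning
  m : ℕ → ℕ
  m n = suc (n ^ (k + l))
eval-≤ (p ⊗ q) with eval-≤ p | eval-≤ q
... | c , k , p≤ | d , l , q≤ = c * d * 4 , k + l , λ n → begin
  eval p n * eval q n                      ≤⟨ *-mono-≤ (p≤ n) (q≤ n) ⟩
  (c * suc (n ^ k)) * (d * suc (n ^ l))    ≡⟨ [m*n]*[o*p]≡[m*o]*[n*p] c _ d _ ⟩
  (c * d) * (suc (n ^ k) * suc (n ^ l))    ≤⟨ *-monoʳ-≤ (c * d) (1+n^-*-≤ n k l) ⟩
  (c * d) * (4 * suc (n ^ (k + l)))        ≡⟨ ≡.sym (*-assoc (c * d) 4 _) ⟩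
  c * d * 4 * suc (n ^ (k + l))            ∎
  where open ≤-Reasoning

-- Linking programs

rename : ∀ {m n} → (Fin m → Fin n) → Expr m → Expr n
rename ρ var                  = var
rename ρ empty                = empty
rename ρ (pair a b)           = pair (rename ρ a) (rename ρ b)
rename ρ (hd a)               = hd (rename ρ a)
rename ρ (tl a)               = tl (rename ρ a)
rename ρ (if a then b else c) = if rename ρ a then rename ρ b else rename ρ c
rename ρ (call f a)           = call (ρ f) (rename ρ a)

module _ {P Q : Program} where
  open Program

  -- Renaming changes only the targets of calls, so the derivation keeps its shape and its step
  -- count.
  rename-⇓ : (ρ : Fin (#procedures P) → Fin (#procedures Q)) →
             (∀ f → body Q (ρ f) ≡ rename ρ (body P f)) →
             ∀ {x e v n} → P ∣ x ⊢ e ⇓ v [ n ] → Q ∣ x ⊢ rename ρ e ⇓ v [ n ]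
  rename-⇓ ρ ρ-body ⇓var        = ⇓var
  rename-⇓ ρ ρ-body ⇓empty      = ⇓empty
  rename-⇓ ρ ρ-body (⇓pair a b) = ⇓pair (rename-⇓ ρ ρ-body a) (rename-⇓ ρ ρ-body b)
  rename-⇓ ρ ρ-body (⇓hd a)     = ⇓hd (rename-⇓ ρ ρ-body a)
  rename-⇓ ρ ρ-body (⇓tl a)     = ⇓tl (rename-⇓ ρ ρ-body a)
  rename-⇓ ρ ρ-body (⇓then a b) = ⇓then (rename-⇓ ρ ρ-body a) (rename-⇓ ρ ρ-body b)
  rename-⇓ ρ ρ-body (⇓else a c) = ⇓else (rename-⇓ ρ ρ-body a) (rename-⇓ ρ ρ-body c)
  rename-⇓ ρ ρ-body (⇓call {f} a b) =
    ⇓call (rename-⇓ ρ ρ-body a)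
          (subst (λ e → Q ∣ _ ⊢ e ⇓ _ [ _ ]) (≡.sym (ρ-body f)) (rename-⇓ ρ ρ-body b))

pattern self   = zero
pattern first  = suc zero
pattern second = suc (suc zero)

-- The expression e becomes both the main expression and the procedure `self`;
-- `first` and `second` run P and Q.
module Link (P Q : Program)
            (e : Expr (3 + (Program.#procedures P + Program.#procedures Q))) where
  open Program

  ρ₁ : Fin (#procedures P) → Fin (3 + (#procedures P + #procedures Q))
  ρ₁ f = suc (suc (suc (f ↑ˡ #procedures Q)))

  ρ₂ : Fin (#procedures Q) → Fin (3 + (#procedures P + #procedures Q))
  ρ₂ f = suc (suc (suc (#procedures P ↑ʳ f)))

  linked : Program
  linked .#procedures             = 3 + (#procedures P + #procedures Q)
  linked .body self               = e
  linked .body first              = rename ρ₁ (main P)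
  linked .body second             = rename ρ₂ (main Q)
  linked .body (suc (suc (suc f))) =
    [ rename ρ₁ ∘ body P , rename ρ₂ ∘ body Q ]′ (splitAt (#procedures P) f)
  linked .main                    = e

  first⇓ : ∀ {x v n} → P ∣ x ⊢ main P ⇓ v [ n ] → linked ∣ x ⊢ body linked first ⇓ v [ n ]
  first⇓ = rename-⇓ ρ₁ λ f →
    ≡.cong [ rename ρ₁ ∘ body P , rename ρ₂ ∘ body Q ]′ (Fin.splitAt-↑ˡ (#procedures P) f (#procedures Q))

  second⇓ : ∀ {x v n} → Q ∣ x ⊢ main Q ⇓ v [ n ] → linked ∣ x ⊢ body linked second ⇓ v [ n ]
  second⇓ = rename-⇓ ρ₂ λ f →
    ≡.cong [ rename ρ₁ ∘ body P , rename ρ₂ ∘ body Q ]′ (Fin.splitAt-↑ʳ (#procedures P) (#procedures Q) f)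

-- Polynomial-time functions

size : Tree → ℕ
size nil     = 1
size (u ∙ v) = suc (size u + size v)

size-head : ∀ t → size (head t) ≤ size t
size-head nil     = ≤-refl
size-head (u ∙ v) = ≤-trans (m≤m+n _ _) (n≤1+n _)

size-tail : ∀ t → size (tail t) ≤ size t
size-tail nil     = ≤-refl
size-tail (u ∙ v) = ≤-trans (m≤n+m _ _) (n≤1+n _)

-- Sharing lets values grow exponentially in the number of steps, so a bound on the
-- output size does not follow from the time bound.
record PolyTime (f : Tree → Tree) : Set where
  field
    program : Program
    time    : Polynomial
    space   : Polynomial
    runs    : ∀ x → ∃[ n ]
                program ∣ x ⊢ Program.main program ⇓ f x [ n ] × n ≤ eval time (size x)
    size≤   : ∀ x → size (f x) ≤ eval space (size x)

open PolyTime

PolyTime-cong : ∀ {f g} → (∀ x → f x ≡ g x) → PolyTime f → PolyTime g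
PolyTime-cong f≗g F .program = program F
PolyTime-cong f≗g F .time    = time F
PolyTime-cong f≗g F .space   = space F
PolyTime-cong f≗g F .runs x  =
  subst (λ y → ∃[ n ] _ ∣ _ ⊢ _ ⇓ y [ n ] × n ≤ _) (f≗g x) (runs F x)
PolyTime-cong f≗g F .size≤ x = subst (λ y → size y ≤ _) (f≗g x) (size≤ F x)

idᵖ : PolyTime id
idᵖ .program = record { #procedures = 0 ; body = λ () ; main = var }
idᵖ .time    = const 1
idᵖ .space   = X
idᵖ .runs x  = 1 , ⇓var , ≤-refl
idᵖ .size≤ x = ≤-refl

nilᵖ : PolyTime (λ _ → nil)
nilᵖ .program = record { #procedures = 0 ; body = λ () ; main = empty }
nilᵖ .time    = const 1
nilᵖ .space   = const 1
nilᵖ .runs x  = 1 , ⇓empty , ≤-refl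
nilᵖ .size≤ x = ≤-refl

module _ {f g : Tree → Tree} where

  infixr 5 _∙ᵖ_
  infixr 9 _∘ᵖ_

  _∙ᵖ_ : PolyTime f → PolyTime g → PolyTime (λ x → f x ∙ g x)
  (F ∙ᵖ G) .program = Link.linked (program F) (program G) (pair (call first var) (call second var))
  (F ∙ᵖ G) .time    = const 1 ⊕ ((const 2 ⊕ time F) ⊕ (const 2 ⊕ time G))
  (F ∙ᵖ G) .space   = const 1 ⊕ (space F ⊕ space G)
  (F ∙ᵖ G) .runs x with runs F x | runs G x
  ... | _ , F⇓ , m≤ | _ , G⇓ , n≤ =
    _ , ⇓pair (⇓call ⇓var (first⇓ F⇓)) (⇓call ⇓var (second⇓ G⇓)) ,
    s≤s (+-mono-≤ (s≤s (s≤s m≤)) (s≤s (s≤s n≤)))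
    where open Link (program F) (program G) (pair (call first var) (call second var))
  (F ∙ᵖ G) .size≤ x = s≤s (+-mono-≤ (size≤ F x) (size≤ G x))

  _∘ᵖ_ : PolyTime f → PolyTime g → PolyTime (f ∘ g)
  (F ∘ᵖ G) .program = Link.linked (program F) (program G) (call first (call second var))
  -- `F` runs on the output of `G`, so its time is measured at `space G`.
  (F ∘ᵖ G) .time    = const 1 ⊕ ((const 2 ⊕ time G) ⊕ (time F ∘ₚ space G))
  (F ∘ᵖ G) .space   = space F ∘ₚ space G
  (F ∘ᵖ G) .runs x with runs F (g x) | runs G x
  ... | _ , F⇓ , m≤ | _ , G⇓ , n≤ =
    _ , ⇓call (⇓call ⇓var (second⇓ G⇓)) (first⇓ F⇓) ,
    s≤s (+-mono-≤ (s≤s (s≤s n≤))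
      (≤-trans m≤ (≤-trans (eval-mono (time F) (size≤ G x))
                           (≤-reflexive (≡.sym (eval-∘ₚ (time F) (space G) _))))))
    where open Link (program F) (program G) (call first (call second var))
  (F ∘ᵖ G) .size≤ x =
    ≤-trans (size≤ F (g x)) (≤-trans (eval-mono (space F) (size≤ G x))
                                     (≤-reflexive (≡.sym (eval-∘ₚ (space F) (space G) _))))

headᵖ : ∀ {f} → PolyTime f → PolyTime (λ x → head (f x))
headᵖ F = prim ∘ᵖ F
  where
  prim : PolyTime head
  prim .program = record { #procedures = 0 ; body = λ () ; main = hd var }
  prim .time    = const 2
  prim .space   = X
  prim .runs x  = 2 , ⇓hd ⇓var , ≤-refl
  prim .size≤   = size-head

tailᵖ : ∀ {f} → PolyTime f → PolyTime (λ x → tail (f x))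
tailᵖ F = prim ∘ᵖ F
  where
  prim : PolyTime tail
  prim .program = record { #procedures = 0 ; body = λ () ; main = tl var }
  prim .time    = const 2
  prim .space   = X
  prim .runs x  = 2 , ⇓tl ⇓var , ≤-refl
  prim .size≤   = size-tail

cond : Tree → Tree → Tree → Tree
cond nil     v w = w
cond (_ ∙ _) v w = v

-- Both branches are computed before the choice, so their costs add up.
condᵖ : ∀ {f g h} → PolyTime f → PolyTime g → PolyTime h → PolyTime (λ x → cond (f x) (g x) (h x))
condᵖ F G H = prim ∘ᵖ (F ∙ᵖ (G ∙ᵖ H))
  where
  prim : PolyTime (λ x → cond (head x) (head (tail x)) (tail (tail x)))
  prim .program = record { #procedures = 0 ; body = λ ()
                         ; main = if hd var then hd (tl var) else tl (tl var) }
  prim .time    = const 6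
  prim .space   = X
  prim .runs nil               = _ , ⇓else (⇓hd ⇓var) (⇓tl (⇓tl ⇓var)) , ≤-refl
  prim .runs (nil ∙ _)         = _ , ⇓else (⇓hd ⇓var) (⇓tl (⇓tl ⇓var)) , ≤-refl
  prim .runs ((_ ∙ _) ∙ _)     = _ , ⇓then (⇓hd ⇓var) (⇓hd (⇓tl ⇓var)) , ≤-refl
  prim .size≤ nil              = ≤-refl
  prim .size≤ x@(nil ∙ _)      = ≤-trans (size-tail (tail x)) (size-tail x)
  prim .size≤ x@((_ ∙ _) ∙ _)  = ≤-trans (size-head (tail x)) (size-tail x)

constᵖ : ∀ t → PolyTime (λ _ → t)
constᵖ nil     = nilᵖ
constᵖ (u ∙ v) = constᵖ u ∙ᵖ constᵖ v

true : Tree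
true = nil ∙ nil

-- Trees as lists

items : Tree → List Tree
items nil     = []
items (u ∙ v) = u ∷ items v

fromList : List Tree → Tree
fromList []       = nil
fromList (t ∷ ts) = t ∙ fromList ts

items-fromList : ∀ ts → items (fromList ts) ≡ ts
items-fromList []       = refl
items-fromList (t ∷ ts) = ≡.cong (t ∷_) (items-fromList ts)

-- Procedures are unary and first-order: one tree carries parameter, element and accumulator, and
-- the parameter `p` takes the place of a closure.
fold : (Tree → Tree) → Tree → Tree → Tree → Tree
fold h p z l = foldr (λ e a → h ((p ∙ e) ∙ a)) z (items l)

module _ {h : Tree → Tree} (H : PolyTime h) (growth : Polynomial)
         (h-grows : ∀ p e a → size (h ((p ∙ e) ∙ a)) ≤ eval growth (size (p ∙ e)) + size a)
  where

  -- Each round adds to the accumulator an amount that does not depend on it. If a round could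
  -- multiply its size, iteration might make it exponential.
  size-fold : ∀ p z l → size (fold h p z l) ≤ size l * eval growth (suc (size p + size l)) + size z
  size-fold p z l = go l ≤-refl
    where
    g : ℕ
    g = eval growth (suc (size p + size l))
    go : ∀ k → size k ≤ size l → size (fold h p z k) ≤ size k * g + size z
    go nil     k≤l = m≤n+m _ _
    go (e ∙ k) k≤l = begin
      size (h ((p ∙ e) ∙ fold h p z k))                          ≤⟨ h-grows p e _ ⟩
      eval growth (size (p ∙ e)) + size (fold h p z k)
        ≤⟨ +-mono-≤ (eval-mono growth pe≤) (go k (≤-trans (size-tail (e ∙ k)) k≤l)) ⟩
      g + (size k * g + size z)                                  ≡⟨ ≡.sym (+-assoc g _ _) ⟩
      suc (size k) * g + size z
        ≤⟨ +-monoˡ-≤ (size z) (*-monoˡ-≤ g (s≤s (m≤n+m (size k) (size e)))) ⟩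
      size (e ∙ k) * g + size z                                  ∎
      where
      open ≤-Reasoning
      pe≤ : size (p ∙ e) ≤ suc (size p + size l)
      pe≤ = s≤s (+-monoʳ-≤ (size p) (≤-trans (size-head (e ∙ k)) k≤l))

  private
    loop : Expr (3 + (Program.#procedures (program H) + 0))
    loop = if tl var
           then call first (pair (pair (hd (hd var)) (hd (tl var)))
                                 (call self (pair (hd var) (tl (tl var)))))
           else tl (hd var)

    module L = Link (program H) (program nilᵖ) loop

    -- Rebuilds the argument as `(p ∙ z) ∙ l`, a shape which an arbitrary input need not have.
    start : Expr (3 + (Program.#procedures L.linked + 0))
    start = call first (pair (pair (hd (hd var)) (tl (hd var))) (tl var))

    module S = Link L.linked (program nilᵖ) start

    outSize argSize stepTime : Polynomial
    outSize  = (X ⊗ (growth ∘ₚ (const 1 ⊕ (X ⊕ X)))) ⊕ X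
    argSize  = const 1 ⊕ ((const 1 ⊕ (X ⊕ X)) ⊕ outSize)
    -- One round takes 19 steps outside `H` and the recursive call.
    stepTime = const 19 ⊕ (time H ∘ₚ argSize)

    size-fold′ : ∀ {n} p z l → size p ≤ n → size z ≤ n → size l ≤ n →
                 size (fold h p z l) ≤ eval outSize n
    size-fold′ {n} p z l p≤ z≤ l≤ = ≤-trans (size-fold p z l)
      (+-mono-≤ (*-mono-≤ l≤ (≤-trans (eval-mono growth (s≤s (+-mono-≤ p≤ l≤)))
                                      (≤-reflexive (≡.sym (eval-∘ₚ growth _ n))))) z≤)

    -- The bound `n` stays fixed while `l` shrinks, so all rounds share the cost `stepTime` at `n`.
    loop⇓ : ∀ {n} p z l → size p ≤ n → size z ≤ n → size l ≤ n →
            ∃[ m ] L.linked ∣ (p ∙ z) ∙ l ⊢ loop ⇓ fold h p z l [ m ]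
                   × m ≤ size l * eval stepTime n
    loop⇓ p z nil p≤ z≤ l≤ =
      _ , ⇓else (⇓tl ⇓var) (⇓tl (⇓hd ⇓var)) , ≤-trans (m≤m+n 6 _) (m≤m+n _ 0)
    loop⇓ {n} p z (e ∙ l) p≤ z≤ l≤
      with loop⇓ {n} p z l p≤ z≤ (≤-trans (size-tail (e ∙ l)) l≤)
         | runs H ((p ∙ e) ∙ fold h p z l)
    ... | i , loop⇓l , i≤ | j , H⇓ , j≤ =
      _ ,
      ⇓then (⇓tl ⇓var)
        (⇓call (⇓pair (⇓pair (⇓hd (⇓hd ⇓var)) (⇓hd (⇓tl ⇓var)))
                      (⇓call (⇓pair (⇓hd ⇓var) (⇓tl (⇓tl ⇓var))) loop⇓l))
               (L.first⇓ H⇓)) ,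
      (begin
        19 + (i + j)                                ≡⟨ ≡.cong (19 +_) (+-comm i j) ⟩
        19 + (j + i)                                ≤⟨ +-monoʳ-≤ 19 (+-mono-≤ j≤′ i≤) ⟩
        eval stepTime n + size l * eval stepTime n
          ≤⟨ *-monoˡ-≤ (eval stepTime n) (s≤s (m≤n+m (size l) (size e))) ⟩
        size (e ∙ l) * eval stepTime n              ∎)
      where
      open ≤-Reasoning
      j≤′ : j ≤ eval (time H ∘ₚ argSize) n
      j≤′ = ≤-trans j≤ (≤-trans
        (eval-mono (time H) (s≤s (+-mono-≤ (s≤s (+-mono-≤ p≤ (≤-trans (size-head (e ∙ l)) l≤)))
                                   (size-fold′ p z l p≤ z≤ (≤-trans (size-tail (e ∙ l)) l≤)))))
        (≤-reflexive (≡.sym (eval-∘ₚ (time H) argSize n))))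

    prim : PolyTime (λ x → fold h (head (head x)) (tail (head x)) (tail x))
    prim .program = S.linked
    prim .time    = const 12 ⊕ (X ⊗ stepTime)
    prim .space   = outSize
    prim .runs x with loop⇓ {size x} (head (head x)) (tail (head x)) (tail x)
                        (≤-trans (size-head (head x)) (size-head x))
                        (≤-trans (size-tail (head x)) (size-head x))
                        (size-tail x)
    ... | i , loop⇓x , i≤ =
      _ , ⇓call (⇓pair (⇓pair (⇓hd (⇓hd ⇓var)) (⇓tl (⇓hd ⇓var))) (⇓tl ⇓var)) (S.first⇓ loop⇓x) ,
      ≤-trans (+-monoʳ-≤ 11 (≤-trans i≤ (*-monoˡ-≤ (eval stepTime (size x)) (size-tail x)))) (n≤1+n _)
    prim .size≤ x = size-fold′ (head (head x)) (tail (head x)) (tail x)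
                        (≤-trans (size-head (head x)) (size-head x))
                        (≤-trans (size-tail (head x)) (size-head x))
                        (size-tail x)

  foldᵖ : ∀ {p z l} → PolyTime p → PolyTime z → PolyTime l →
          PolyTime (λ x → fold h (p x) (z x) (l x))
  foldᵖ P Z L = prim ∘ᵖ ((P ∙ᵖ Z) ∙ᵖ L)

-- Equality of trees and enumeration of subtrees.

equal : Tree → Tree → Tree
equal nil     nil       = true
equal nil     (_ ∙ _)   = nil
equal (_ ∙ _) nil       = nil
equal (u ∙ v) (u′ ∙ v′) = cond (equal u u′) (equal v v′) nil

private
  equalBody : Expr 1
  equalBody =
    if hd var
    then (if tl var
          then (if call zero (pair (hd (hd var)) (hd (tl var)))
                then call zero (pair (tl (hd var)) (tl (tl var)))
                else empty)
          else empty)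
    else (if tl var then empty else pair empty empty)

  equalProgram : Program
  equalProgram = record { #procedures = 1 ; body = λ _ → equalBody
                        ; main = call zero (pair (hd var) (tl var)) }

  -- Both trees are traversed in parallel, so the first alone bounds the time; 23 steps cover one
  -- comparison of inner nodes.
  equal⇓ : ∀ a b → ∃[ n ] equalProgram ∣ a ∙ b ⊢ equalBody ⇓ equal a b [ n ] × n ≤ size a * 23
  equal⇓ nil     nil     = _ , ⇓else (⇓hd ⇓var) (⇓else (⇓tl ⇓var) (⇓pair ⇓empty ⇓empty)) , m≤m+n 9 _
  equal⇓ nil     (_ ∙ _) = _ , ⇓else (⇓hd ⇓var) (⇓then (⇓tl ⇓var) ⇓empty) , m≤m+n 7 _
  equal⇓ (u ∙ v) nil     = _ , ⇓then (⇓hd ⇓var) (⇓else (⇓tl ⇓var) ⇓empty) , m≤m+n 7 _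
  equal⇓ (u ∙ v) (u′ ∙ v′) with equal u u′ | equal⇓ u u′ | equal⇓ v v′
  ... | nil   | m , u⇓ , m≤ | n , v⇓ , n≤ =
    _ ,
    ⇓then (⇓hd ⇓var) (⇓then (⇓tl ⇓var)
      (⇓else (⇓call (⇓pair (⇓hd (⇓hd ⇓var)) (⇓hd (⇓tl ⇓var))) u⇓) ⇓empty)) ,
    (begin
      15 + (m + 1)                        ≡⟨ ≡.cong (15 +_) (+-comm m 1) ⟩
      16 + m                              ≤⟨ +-mono-≤ (m≤m+n 16 7) m≤ ⟩
      23 + size u * 23                    ≤⟨ *-monoˡ-≤ 23 (s≤s (m≤m+n (size u) (size v))) ⟩
      size (u ∙ v) * 23                   ∎)
    where open ≤-Reasoning
  ... | _ ∙ _ | m , u⇓ , m≤ | n , v⇓ , n≤ =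
    _ ,
    ⇓then (⇓hd ⇓var) (⇓then (⇓tl ⇓var)
      (⇓then (⇓call (⇓pair (⇓hd (⇓hd ⇓var)) (⇓hd (⇓tl ⇓var))) u⇓)
             (⇓call (⇓pair (⇓tl (⇓hd ⇓var)) (⇓tl (⇓tl ⇓var))) v⇓))) ,
    (begin
      15 + (m + (8 + n))                  ≡⟨ ≡.cong (15 +_) (x∙yz≈y∙xz +-commutativeSemigroup m 8 n) ⟩
      23 + (m + n)                        ≤⟨ +-monoʳ-≤ 23 (+-mono-≤ m≤ n≤) ⟩
      23 + (size u * 23 + size v * 23)    ≡⟨ ≡.cong (23 +_) (≡.sym (*-distribʳ-+ 23 (size u) (size v))) ⟩
      size (u ∙ v) * 23                   ∎)
    where open ≤-Reasoning

  size-equal : ∀ a b → size (equal a b) ≤ 3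
  size-equal nil     nil       = ≤-refl
  size-equal nil     (_ ∙ _)   = s≤s z≤n
  size-equal (_ ∙ _) nil       = s≤s z≤n
  size-equal (u ∙ v) (u′ ∙ v′) with equal u u′
  ... | nil   = s≤s z≤n
  ... | _ ∙ _ = size-equal v v′

equalᵖ : ∀ {f g} → PolyTime f → PolyTime g → PolyTime (λ x → equal (f x) (g x))
equalᵖ F G = prim ∘ᵖ (F ∙ᵖ G)
  where
  prim : PolyTime (λ x → equal (head x) (tail x))
  prim .program = equalProgram
  prim .time    = const 6 ⊕ (X ⊗ const 23)
  prim .space   = const 3
  prim .runs x with equal⇓ (head x) (tail x)
  ... | n , x⇓ , n≤ =
    _ , ⇓call (⇓pair (⇓hd ⇓var) (⇓tl ⇓var)) x⇓ ,
    +-monoʳ-≤ 6 (≤-trans n≤ (*-monoˡ-≤ 23 (size-head x)))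
  prim .size≤ x = size-equal (head x) (tail x)

-- The accumulator takes the place of concatenation and keeps the running time linear.
subtrees : Tree → Tree → Tree
subtrees nil     a = nil ∙ a
subtrees (u ∙ v) a = (u ∙ v) ∙ subtrees u (subtrees v a)

private
  subtreesBody : Expr 1
  subtreesBody =
    pair (hd var)
         (if hd var
          then call zero (pair (hd (hd var)) (call zero (pair (tl (hd var)) (tl var))))
          else tl var)

  subtreesProgram : Program
  subtreesProgram = record { #procedures = 1 ; body = λ _ → subtreesBody
                           ; main = call zero (pair var empty) }

  subtrees⇓ : ∀ t a → ∃[ n ] subtreesProgram ∣ t ∙ a ⊢ subtreesBody ⇓ subtrees t a [ n ]
                             × n ≤ size t * 18
  subtrees⇓ nil     a = _ , ⇓pair (⇓hd ⇓var) (⇓else (⇓hd ⇓var) (⇓tl ⇓var)) , m≤m+n 8 _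
  subtrees⇓ (u ∙ v) a with subtrees⇓ v a | subtrees⇓ u (subtrees v a)
  ... | n , v⇓ , n≤ | m , u⇓ , m≤ =
    _ ,
    ⇓pair (⇓hd ⇓var) (⇓then (⇓hd ⇓var)
      (⇓call (⇓pair (⇓hd (⇓hd ⇓var))
                    (⇓call (⇓pair (⇓tl (⇓hd ⇓var)) (⇓tl ⇓var)) v⇓))
             u⇓)) ,
    (begin
      18 + (n + m)                        ≡⟨ ≡.cong (18 +_) (+-comm n m) ⟩
      18 + (m + n)                        ≤⟨ +-monoʳ-≤ 18 (+-mono-≤ m≤ n≤) ⟩
      18 + (size u * 18 + size v * 18)    ≡⟨ ≡.cong (18 +_) (≡.sym (*-distribʳ-+ 18 (size u) (size v))) ⟩
      size (u ∙ v) * 18                   ∎)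
    where open ≤-Reasoning

  -- With `n` fixed as a bound for every subtree, each node contributes an entry of size at most `n`
  -- and its list cell: quadratic in total.
  size-subtrees : ∀ {n} t a → size t ≤ n → size (subtrees t a) ≤ size t * (2 + n) + size a
  size-subtrees nil     a t≤n = s≤s (s≤s (m≤n+m _ _))
  size-subtrees {n} (u ∙ v) a t≤n = begin
    suc (size (u ∙ v) + size (subtrees u (subtrees v a)))
      ≤⟨ s≤s (+-mono-≤ t≤n (size-subtrees u _ (≤-trans (size-head (u ∙ v)) t≤n))) ⟩
    suc n + (su * (2 + n) + size (subtrees v a))
      ≤⟨ +-mono-≤ (n≤1+n (suc n)) (+-monoʳ-≤ (su * (2 + n)) (size-subtrees v a (≤-trans (size-tail (u ∙ v)) t≤n))) ⟩
    2 + n + (su * (2 + n) + (sv * (2 + n) + size a))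
      ≡⟨ ≡.cong (2 + n +_) (≡.sym (+-assoc (su * (2 + n)) _ _)) ⟩
    2 + n + (su * (2 + n) + sv * (2 + n) + size a)
      ≡⟨ ≡.cong (λ k → 2 + n + (k + size a)) (≡.sym (*-distribʳ-+ (2 + n) su sv)) ⟩
    2 + n + ((su + sv) * (2 + n) + size a)                  ≡⟨ ≡.sym (+-assoc (2 + n) _ _) ⟩
    size (u ∙ v) * (2 + n) + size a                         ∎
    where
    open ≤-Reasoning
    su sv : ℕ
    su = size u
    sv = size v

subtreesᵖ : ∀ {f} → PolyTime f → PolyTime (λ x → subtrees (f x) nil)
subtreesᵖ F = prim ∘ᵖ F
  where
  prim : PolyTime (λ x → subtrees x nil)
  prim .program = subtreesProgram
  prim .time    = const 4 ⊕ (X ⊗ const 18)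
  prim .space   = (X ⊗ (const 2 ⊕ X)) ⊕ const 1
  prim .runs x with subtrees⇓ x nil
  ... | n , x⇓ , n≤ = _ , ⇓call (⇓pair ⇓var ⇓empty) x⇓ , +-monoʳ-≤ 4 n≤
  prim .size≤ x = size-subtrees x nil ≤-refl

subtrees-root : ∀ t {a} → t ∈ items (subtrees t a)
subtrees-root nil     = here refl
subtrees-root (u ∙ v) = here refl

subtrees-⊇ : ∀ t {a} → items a ⊆ items (subtrees t a)
subtrees-⊇ nil     = there
subtrees-⊇ (u ∙ v) = there ∘ subtrees-⊇ u ∘ subtrees-⊇ v

SubtreeClosed : List Tree → Set
SubtreeClosed N = ∀ {u v} → u ∙ v ∈ N → u ∈ N × v ∈ N

subtrees-closed : ∀ t {a} → SubtreeClosed (items a) → SubtreeClosed (items (subtrees t a))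
subtrees-closed nil a-closed (there uv∈) = let u∈ , v∈ = a-closed uv∈ in there u∈ , there v∈
subtrees-closed (u ∙ v) a-closed (here refl) =
  there (subtrees-root u) , there (subtrees-⊇ u (subtrees-root v))
subtrees-closed (u ∙ v) a-closed (there uv∈) =
  let u∈ , v∈ = subtrees-closed u (subtrees-closed v a-closed) uv∈ in there u∈ , there v∈

-- Polynomial-time decidable predicates

-- Indexed by the shape of the answer, so that matching on the proof also reduces every `cond` on
-- that answer.
data _Decides_ : Tree → Set → Set₁ where
  accept : ∀ {u v Q} → Q → (u ∙ v) Decides Q
  reject  : ∀ {Q} → ¬ Q → nil Decides Q

toDec : ∀ {t Q} → t Decides Q → Dec Q
toDec (accept q) = yes q
toDec (reject ¬q) = no ¬q

record PolyDec (Q : Tree → Set) : Set₁ where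
  field
    test    : Tree → Tree
    testᵖ   : PolyTime test
    correct : ∀ x → test x Decides Q x

  decide : ∀ x → Dec (Q x)
  decide x = toDec (correct x)

open PolyDec

module _ {Q : Tree → Set} where

  ¬ᵈ_ : PolyDec Q → PolyDec (λ x → ¬ Q x)
  (¬ᵈ d) .test x  = cond (test d x) nil true
  (¬ᵈ d) .testᵖ   = condᵖ (testᵖ d) nilᵖ (constᵖ true)
  (¬ᵈ d) .correct x with test d x | correct d x
  ... | _ | accept q = reject λ ¬q → ¬q q
  ... | _ | reject ¬q = accept ¬q

  infixr 9 _∘ᵈ_

  _∘ᵈ_ : ∀ {f} → PolyDec Q → PolyTime f → PolyDec (λ x → Q (f x))
  _∘ᵈ_ {f} d F .test x  = test d (f x)
  (d ∘ᵈ F) .testᵖ   = testᵖ d ∘ᵖ F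
  _∘ᵈ_ {f} d F .correct x = correct d (f x)

  module _ (d : PolyDec Q) where

    -- Step functions for `fold`: `head y` is the parameter paired with the element, `tail y` the
    -- accumulator.
    some keep : Tree → Tree
    some y = cond (test d (head y)) true (tail y)
    keep y = cond (test d (head y)) (tail (head y) ∙ tail y) (tail y)

    some-decides : ∀ p l → fold some p nil l Decides (∃[ e ] e ∈ items l × Q (p ∙ e))
    some-decides p nil     = reject λ { (_ , () , _) }
    some-decides p (e ∙ l) with test d (p ∙ e) | correct d (p ∙ e)
    ... | _ | accept q = accept (e , here refl , q)
    ... | _ | reject ¬q with fold some p nil l | some-decides p l
    ...   | _ | accept (e′ , e′∈ , q) = accept (e′ , there e′∈ , q)
    ...   | _ | reject ¬∃ = reject λ { (_ , here refl , q) → ¬q q ; (e′ , there e′∈ , q) → ¬∃ (e′ , e′∈ , q) }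

    ∃ᵈ : ∀ {p l} → PolyTime p → PolyTime l → PolyDec (λ x → ∃[ e ] e ∈ items (l x) × Q (p x ∙ e))
    ∃ᵈ {p} {l} P L .test x    = fold some (p x) nil (l x)
    ∃ᵈ P L .testᵖ             =
      -- A step returns the accumulator or `true`, whose size is 3.
      foldᵖ (condᵖ (testᵖ d ∘ᵖ headᵖ idᵖ) (constᵖ true) (tailᵖ idᵖ)) (const 3) some-grows P nilᵖ L
      where
      some-grows : ∀ p e a → size (some ((p ∙ e) ∙ a)) ≤ 3 + size a
      some-grows p e a with test d (p ∙ e)
      ... | nil   = m≤n+m _ 3
      ... | _ ∙ _ = m≤m+n 3 _
    ∃ᵈ {p} {l} P L .correct x = some-decides (p x) (l x)

    keep-filter : ∀ p l → fold keep p nil l ≡ fromList (filter (λ e → decide d (p ∙ e)) (items l))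
    keep-filter p nil     = refl
    keep-filter p (e ∙ l) with test d (p ∙ e) | correct d (p ∙ e)
    ... | _ | accept q = ≡.cong (e ∙_) (keep-filter p l)
    ... | _ | reject ¬q = keep-filter p l

    filterᵖ : ∀ {p l} → PolyTime p → PolyTime l →
              PolyTime (λ x → fromList (filter (λ e → decide d (p x ∙ e)) (items (l x))))
    filterᵖ {p} {l} P L = PolyTime-cong (λ x → keep-filter (p x) (l x))
      (foldᵖ (condᵖ (testᵖ d ∘ᵖ headᵖ idᵖ) (tailᵖ (headᵖ idᵖ) ∙ᵖ tailᵖ idᵖ) (tailᵖ idᵖ)) X keep-grows P nilᵖ L)
      where
      keep-grows : ∀ p e a → size (keep ((p ∙ e) ∙ a)) ≤ size (p ∙ e) + size a
      keep-grows p e a with test d (p ∙ e)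
      ... | nil   = m≤n+m _ _
      ... | _ ∙ _ = s≤s (+-monoˡ-≤ (size a) (m≤n+m (size e) (size p)))

module _ {Q R : Tree → Set} where

  infixr 2 _×ᵈ_
  infixr 1 _⊎ᵈ_

  _×ᵈ_ : PolyDec Q → PolyDec R → PolyDec (λ x → Q x × R x)
  (d ×ᵈ e) .test x  = cond (test d x) (test e x) nil
  (d ×ᵈ e) .testᵖ   = condᵖ (testᵖ d) (testᵖ e) nilᵖ
  (d ×ᵈ e) .correct x with test d x | correct d x | test e x | correct e x
  ... | _ | accept q | _ | accept r = accept (q , r)
  ... | _ | accept q | _ | reject ¬r = reject (¬r ∘ proj₂)
  ... | _ | reject ¬q | _ | _     = reject (¬q ∘ proj₁)

  _⊎ᵈ_ : PolyDec Q → PolyDec R → PolyDec (λ x → Q x ⊎ R x)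
  (d ⊎ᵈ e) .test x  = cond (test d x) true (test e x)
  (d ⊎ᵈ e) .testᵖ   = condᵖ (testᵖ d) (constᵖ true) (testᵖ e)
  (d ⊎ᵈ e) .correct x with test d x | correct d x | test e x | correct e x
  ... | _ | accept q | _ | _     = accept (inj₁ q)
  ... | _ | reject ¬q | _ | accept r = accept (inj₂ r)
  ... | _ | reject ¬q | _ | reject ¬r = reject [ ¬q , ¬r ]′

equal-decides : ∀ a b → equal a b Decides (a ≡ b)
equal-decides nil     nil       = accept refl
equal-decides nil     (_ ∙ _)   = reject λ ()
equal-decides (_ ∙ _) nil       = reject λ ()
equal-decides (u ∙ v) (u′ ∙ v′) with equal u u′ | equal-decides u u′ | equal v v′ | equal-decides v v′
... | _ | accept refl | _ | accept refl = accept refl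
... | _ | accept refl | _ | reject v≢v′  = reject λ { refl → v≢v′ refl }
... | _ | reject u≢u′  | _ | _        = reject λ { refl → u≢u′ refl }


_≟ᵗ_ : (a b : Tree) → Dec (a ≡ b)
a ≟ᵗ b = toDec (equal-decides a b)

infix 4 _≡ᵈ_ _∈ᵈ_

_≡ᵈ_ : ∀ {f g} → PolyTime f → PolyTime g → PolyDec (λ x → f x ≡ g x)
_≡ᵈ_ {f} {g} F G .test x    = equal (f x) (g x)
(F ≡ᵈ G) .testᵖ             = equalᵖ F G
_≡ᵈ_ {f} {g} F G .correct x = equal-decides (f x) (g x)

PolyDec-map : ∀ {Q R} → (∀ {x} → Q x ⇔ R x) → PolyDec Q → PolyDec R
PolyDec-map Q⇔R d .test    = test d
PolyDec-map Q⇔R d .testᵖ   = testᵖ d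
PolyDec-map Q⇔R d .correct x with test d x | correct d x
... | _ | accept q = accept (Equivalence.to Q⇔R q)
... | _ | reject ¬q = reject (¬q ∘ Equivalence.from Q⇔R)

_∈ᵈ_ : ∀ {f l} → PolyTime f → PolyTime l → PolyDec (λ x → f x ∈ items (l x))
F ∈ᵈ L = PolyDec-map (mk⇔ (λ { (_ , e∈ , refl) → e∈ }) (λ e∈ → _ , e∈ , refl))
                     (∃ᵈ (headᵖ idᵖ ≡ᵈ tailᵖ idᵖ) F L)

-- Least fixed points

module _ {A : Set} {P Q : A → Set} (P? : ∀ x → Dec (P x)) (Q? : ∀ x → Dec (Q x))
         (P⊆Q : ∀ {x} → P x → Q x) where

  length-filter-mono : ∀ xs → length (filter P? xs) ≤ length (filter Q? xs)
  length-filter-mono []       = z≤n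
  length-filter-mono (x ∷ xs) with P? x | Q? x
  ... | yes p | yes q = s≤s (length-filter-mono xs)
  ... | yes p | no ¬q = ⊥-elim (¬q (P⊆Q p))
  ... | no ¬p | yes q = m≤n⇒m≤1+n (length-filter-mono xs)
  ... | no ¬p | no ¬q = length-filter-mono xs

  -- Makes the length a measure of progress: the weaker predicate keeps either nothing new or
  -- strictly more entries.
  filter-⊇⊎< : ∀ xs → filter Q? xs ⊆ filter P? xs ⊎ length (filter P? xs) < length (filter Q? xs)
  filter-⊇⊎< []       = inj₁ id
  filter-⊇⊎< (x ∷ xs) with P? x | Q? x
  ... | yes p | no ¬q = ⊥-elim (¬q (P⊆Q p))
  ... | no ¬p | yes q = inj₂ (s≤s (length-filter-mono xs))
  ... | no ¬p | no ¬q = filter-⊇⊎< xs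
  ... | yes p | yes q with filter-⊇⊎< xs
  ...   | inj₁ Q⊆P = inj₁ λ { (here e) → here e ; (there x∈) → there (Q⊆P x∈) }
  ...   | inj₂ P<Q = inj₂ (s≤s P<Q)

module Iteration {A : Set} {D : List A → A → Set} (D? : ∀ E u → Dec (D E u)) (U : List A) where

  stage : ℕ → List A
  stage zero    = []
  stage (suc k) = filter (D? (stage k)) U

  limit : List A
  limit = stage (length U)

  module Monotone (D-mono : ∀ {E E′ u} → E ⊆ E′ → D E u → D E′ u) where

    stage-mono : ∀ {k l} → stage k ⊆ stage l → stage (suc k) ⊆ stage (suc l)
    stage-mono {k} {l} k⊆l u∈ =
      let u∈U , d = ∈-filter⁻ (D? (stage k)) {xs = U} u∈
      in  ∈-filter⁺ (D? (stage l)) u∈U (D-mono k⊆l d)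

    stage-⊆ : ∀ k → stage k ⊆ stage (suc k)
    stage-⊆ zero    ()
    stage-⊆ (suc k) = stage-mono {k} {suc k} (stage-⊆ k)

    stable⊎< : ∀ k → stage (suc k) ⊆ stage k ⊎ length (stage k) < length (stage (suc k))
    -- Stage 0 is not a filter of `U`, so the comparison of filters starts with stage 1.
    stable⊎< zero with filter (D? []) U
    ... | []    = inj₁ id
    ... | _ ∷ _ = inj₂ (s≤s z≤n)
    stable⊎< (suc k) = filter-⊇⊎< (D? (stage k)) (D? (stage (suc k))) (D-mono (stage-⊆ k)) U

    -- Until the stages become stable, each round gains at least one entry.
    stable⊎≤ : ∀ k → stage (suc k) ⊆ stage k ⊎ k ≤ length (stage k)
    stable⊎≤ zero = inj₂ z≤n
    stable⊎≤ (suc k) with stable⊎≤ k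
    ... | inj₁ stable = inj₁ (stage-mono {suc k} {k} stable)
    ... | inj₂ k≤ with stable⊎< k
    ...   | inj₁ stable = inj₁ (stage-mono {suc k} {k} stable)
    ...   | inj₂ k<     = inj₂ (≤-trans (s≤s k≤) k<)

    -- Growth beyond this stage would give a filter of `U` longer than `U`.
    limit-stable : stage (suc (length U)) ⊆ limit
    limit-stable with stable⊎≤ (length U)
    ... | inj₁ stable = stable
    ... | inj₂ U≤ with stable⊎< (length U)
    ...   | inj₁ stable = stable
    ...   | inj₂ U<     = ⊥-elim (<⇒≱ (≤-trans (s≤s U≤) U<) (length-filter (D? limit) U))

    limit-closed : ∀ {u} → u ∈ U → D limit u → u ∈ limit
    limit-closed u∈U d = limit-stable (∈-filter⁺ (D? limit) u∈U d)

size-fromList-filter : ∀ {P : Tree → Set} (P? : ∀ t → Dec (P t)) l →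
                       size (fromList (filter P? (items l))) ≤ size l
size-fromList-filter P? nil     = ≤-refl
size-fromList-filter P? (e ∙ l) with P? e
... | yes _ = s≤s (+-monoʳ-≤ (size e) (size-fromList-filter P? l))
... | no  _ = ≤-trans (size-fromList-filter P? l) (size-tail (e ∙ l))

module _ {Q : Tree → Set} (d : PolyDec Q) where

  private
    Q? : ∀ p E u → Dec (Q ((p ∙ fromList E) ∙ u))
    Q? p E u = decide d ((p ∙ fromList E) ∙ u)

  opaque

    limit : Tree → Tree → Tree
    limit p l = fromList (Iteration.limit (Q? p) (items l))

    limitᵖ : ∀ {p l} → PolyTime p → PolyTime l → PolyTime (λ x → limit (p x) (l x))
    limitᵖ {p} {l} P L =
      -- The list `l x` is also the clock: one round for each of its entries.
      PolyTime-cong (λ x → fold-stage (p x) (l x) (l x))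
        (foldᵖ (filterᵖ d (headᵖ (headᵖ (headᵖ idᵖ)) ∙ᵖ tailᵖ idᵖ) (tailᵖ (headᵖ (headᵖ idᵖ)))) X
               -- Every stage is a sublist of the universe, which is part of the parameter.
               (λ { (q ∙ l) e a → ≤-trans (size-fromList-filter _ l)
                      (≤-trans (≤-trans (size-tail (q ∙ l)) (size-head ((q ∙ l) ∙ e))) (m≤m+n _ _))
                  ; nil e a → s≤s z≤n })
               (P ∙ᵖ L) nilᵖ L)
      where
      next : Tree → Tree
      next y = fromList (filter (λ u → decide d ((head (head (head y)) ∙ tail y) ∙ u))
                                (items (tail (head (head y)))))
      fold-stage : ∀ p l k → fold next (p ∙ l) nil k
                             ≡ fromList (Iteration.stage (Q? p) (items l) (length (items k)))
      fold-stage p l nil     = refl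
      fold-stage p l (e ∙ k) rewrite fold-stage p l k = refl

    -- The index of `R` is the number of rounds so far: soundness is the same at every stage,
    -- whereas the depth bound grows with it. Stage 0 is empty, hence there is no base case.
    limit-induction : ∀ {p l} (R : ℕ → Tree → Set) →
      (∀ {k E u} → (∀ {e} → e ∈ items E → R k e) → u ∈ items l → Q ((p ∙ E) ∙ u) → R (suc k) u) →
      ∀ {u} → u ∈ items (limit p l) → R (length (items l)) u
    limit-induction {p} {l} R R-step u∈ =
      go (length (items l)) (subst (_ ∈_) (items-fromList _) u∈)
      where
      go : ∀ k {u} → u ∈ Iteration.stage (Q? p) (items l) k → R k u
      go (suc k) u∈ =
        let u∈l , q = ∈-filter⁻ (Q? p _) {xs = items l} u∈
        in  R-step (go k ∘ subst (_ ∈_) (items-fromList _)) u∈l q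

    limit-closed : ∀ {p l} →
      (∀ {E E′ u} → items E ⊆ items E′ → Q ((p ∙ E) ∙ u) → Q ((p ∙ E′) ∙ u)) →
      ∀ {u} → u ∈ items l → Q ((p ∙ limit p l) ∙ u) → u ∈ items (limit p l)
    limit-closed {p} {l} Q-mono u∈l q =
      subst (_ ∈_) (≡.sym (items-fromList _))
        (Iteration.Monotone.limit-closed (Q? p) (items l)
          (λ {E} {E′} E⊆E′ → Q-mono (subst (_ ∈_) (≡.sym (items-fromList E′))
                                      ∘ E⊆E′ ∘ subst (_ ∈_) (items-fromList E)))
          u∈l q)

-- Congruence closure

-- A derivation of p ∼ q may leave N even if p and q are in N.  Nevertheless E, closed
-- under the rules within N only, relates p and q: it is the restriction to N of a
-- congruence ≈ on all terms.
module Extension {S : Signature} (Γ : Equations S)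
  (N : Term S → Set) (E : Term S → Term S → Set)
  (N-args   : ∀ {f ts} → N (app f ts) → All N ts)
  (N-axiom  : ∀ {p q} → (p , q) ∈ Γ → N p × N q)
  (E-axiom  : ∀ {p q} → (p , q) ∈ Γ → E p q)
  (E-euclid : ∀ {p q r} → N p → N q → N r → E p q → E p r → E q r)
  (E-con    : ∀ {c} → N (con c) → E (con c) (con c))
  (E-app    : ∀ {f ps qs} → N (app f ps) → N (app f qs) → Pointwise E ps qs → E (app f ps) (app f qs))
  where

  infix 4 _≈_ _≈ᶜ_

  -- `≈ᶜ` fixes the head symbol, and `via` adds one passage through `E` at the root. One is enough,
  -- since whatever lies between two passages can be absorbed into `E`.
  data _≈_ : Term S → Term S → Set
  data _≈ᶜ_ : Term S → Term S → Set
  data _≈_ where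
    direct : ∀ {p q} → p ≈ᶜ q → p ≈ q
    via    : ∀ {p p′ q′ q} → p ≈ᶜ p′ → N p′ → N q′ → E p′ q′ → q′ ≈ᶜ q → p ≈ q
  data _≈ᶜ_ where
    con : ∀ {c} → con c ≈ᶜ con c
    app : ∀ {f ps qs} → Pointwise _≈_ ps qs → app f ps ≈ᶜ app f qs

  ≈-refl  : ∀ {p} → p ≈ p
  ≈ᶜ-refl : ∀ {p} → p ≈ᶜ p
  ≈-refl* : ∀ {n} {ps : Vec (Term S) n} → Pointwise _≈_ ps ps
  ≈-refl                 = direct ≈ᶜ-refl
  ≈ᶜ-refl {con c}        = con
  ≈ᶜ-refl {app f ts}     = app ≈-refl*
  ≈-refl* {ps = []}      = []
  ≈-refl* {ps = p ∷ ps}  = ≈-refl ∷ ≈-refl*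

  -- Reflexivity on `N` comes from the congruence rules by recursion on the term. Together with the
  -- Euclidean rule it yields symmetry and transitivity.
  E-refl  : ∀ {p} → N p → E p p
  E-refl* : ∀ {n} {ps : Vec (Term S) n} → All N ps → Pointwise E ps ps
  E-refl {con c}    p∈ = E-con p∈
  E-refl {app f ts} p∈ = E-app p∈ p∈ (E-refl* (N-args p∈))
  E-refl* {ps = []}     []         = []
  E-refl* {ps = p ∷ ps} (p∈ ∷ ps∈) = E-refl p∈ ∷ E-refl* ps∈

  E-sym : ∀ {p q} → N p → N q → E p q → E q p
  E-sym p∈ q∈ pq = E-euclid p∈ q∈ p∈ pq (E-refl p∈)

  E-trans : ∀ {p q r} → N p → N q → N r → E p q → E q r → E p r
  E-trans p∈ q∈ r∈ pq qr = E-euclid q∈ p∈ r∈ (E-sym p∈ q∈ pq) qr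

  -- Arguments of members of `N` are in `N`, so each congruence step between members of `N` is an
  -- instance of a rule for `E`.
  E-restrict  : ∀ {p q} → N p → N q → p ≈ q → E p q
  E-restrictᶜ : ∀ {p q} → N p → N q → p ≈ᶜ q → E p q
  E-restrict* : ∀ {n} {ps qs : Vec (Term S) n} → All N ps → All N qs → Pointwise _≈_ ps qs → Pointwise E ps qs
  E-restrict p∈ q∈ (direct p≈q) = E-restrictᶜ p∈ q∈ p≈q
  E-restrict p∈ q∈ (via p≈p′ p′∈ q′∈ p′q′ q′≈q) =
    E-trans p∈ q′∈ q∈ (E-trans p∈ p′∈ q′∈ (E-restrictᶜ p∈ p′∈ p≈p′) p′q′) (E-restrictᶜ q′∈ q∈ q′≈q)
  E-restrictᶜ p∈ q∈ con         = E-con p∈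
  E-restrictᶜ p∈ q∈ (app ps≈qs) = E-app p∈ q∈ (E-restrict* (N-args p∈) (N-args q∈) ps≈qs)
  E-restrict* []         []         []            = []
  E-restrict* (p∈ ∷ ps∈) (q∈ ∷ qs∈) (p≈q ∷ ps≈qs) = E-restrict p∈ q∈ p≈q ∷ E-restrict* ps∈ qs∈ ps≈qs

  ≈-sym  : ∀ {p q} → p ≈ q → q ≈ p
  ≈ᶜ-sym : ∀ {p q} → p ≈ᶜ q → q ≈ᶜ p
  ≈-sym* : ∀ {n} {ps qs : Vec (Term S) n} → Pointwise _≈_ ps qs → Pointwise _≈_ qs ps
  ≈-sym (direct p≈q)            = direct (≈ᶜ-sym p≈q)
  ≈-sym (via a p∈ q∈ pq b)      = via (≈ᶜ-sym b) q∈ p∈ (E-sym p∈ q∈ pq) (≈ᶜ-sym a)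
  ≈ᶜ-sym con                    = con
  ≈ᶜ-sym (app ps≈qs)            = app (≈-sym* ps≈qs)
  ≈-sym* []                     = []
  ≈-sym* (p≈q ∷ ps≈qs)          = ≈-sym p≈q ∷ ≈-sym* ps≈qs

  ≈-trans  : ∀ {p q r} → p ≈ q → q ≈ r → p ≈ r
  ≈ᶜ-trans : ∀ {p q r} → p ≈ᶜ q → q ≈ᶜ r → p ≈ᶜ r
  ≈-trans* : ∀ {n} {ps qs rs : Vec (Term S) n} →
             Pointwise _≈_ ps qs → Pointwise _≈_ qs rs → Pointwise _≈_ ps rs
  ≈-trans (direct a)         (direct b)         = direct (≈ᶜ-trans a b)
  ≈-trans (direct a)         (via b p∈ q∈ pq c) = via (≈ᶜ-trans a b) p∈ q∈ pq c
  ≈-trans (via a p∈ q∈ pq b) (direct c)         = via a p∈ q∈ pq (≈ᶜ-trans b c)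
  -- The inner ends `q` and `r` lie in `N`, so `E` relates them and the two passages become one.
  ≈-trans (via a p∈ q∈ pq b) (via c r∈ s∈ rs d) =
    via a p∈ s∈ (E-trans p∈ r∈ s∈ (E-trans p∈ q∈ r∈ pq (E-restrictᶜ q∈ r∈ (≈ᶜ-trans b c))) rs) d
  ≈ᶜ-trans con         con         = con
  ≈ᶜ-trans (app ps≈qs) (app qs≈rs) = app (≈-trans* ps≈qs qs≈rs)
  ≈-trans* []            []            = []
  ≈-trans* (p≈q ∷ ps≈qs) (q≈r ∷ qs≈rs) = ≈-trans p≈q q≈r ∷ ≈-trans* ps≈qs qs≈rs

  ∼⇒≈  : ∀ {p q} → Γ ⊢ p ∼ q → p ≈ q
  ∼⇒≈* : ∀ {n} {ps qs : Vec (Term S) n} → Pointwise (Γ ⊢_∼_) ps qs → Pointwise _≈_ ps qs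
  ∼⇒≈ (axiom pq∈)     = let p∈ , q∈ = N-axiom pq∈ in via ≈ᶜ-refl p∈ q∈ (E-axiom pq∈) ≈ᶜ-refl
  ∼⇒≈ refl            = ≈-refl
  ∼⇒≈ (sym q∼p)       = ≈-sym (∼⇒≈ q∼p)
  ∼⇒≈ (trans p∼q q∼r) = ≈-trans (∼⇒≈ p∼q) (∼⇒≈ q∼r)
  ∼⇒≈ (cong f ps∼qs)  = direct (app (∼⇒≈* ps∼qs))
  ∼⇒≈* []             = []
  ∼⇒≈* (p∼q ∷ ps∼qs)  = ∼⇒≈ p∼q ∷ ∼⇒≈* ps∼qs

  ∼⇒E : ∀ {p q} → N p → N q → Γ ⊢ p ∼ q → E p q
  ∼⇒E p∈ q∈ p∼q = E-restrict p∈ q∈ (∼⇒≈ p∼q)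

-- The closure relates trees both as terms and as argument lists.  A tag keeps the two
-- apart, since a list starting with the constant 0 has the form of an application of
-- the function symbol 0.
termPair listPair : Tree → Tree → Tree
termPair s t = nil ∙ (s ∙ t)
listPair s t = true ∙ (s ∙ t)

-- Axiom, congruence and the Euclidean rule, the last replacing symmetry and transitivity.
TermRule : List Tree → List Tree → List Tree → Tree → Tree → Set
TermRule Γ N E s t =
  s ∙ t ∈ Γ
  ⊎ (head s ≡ head t × listPair (tail s) (tail t) ∈ E)
  ⊎ (∃[ u ] u ∈ N × termPair u s ∈ E × termPair u t ∈ E)

-- As `nil` is its own head and tail, the inequalities are what keeps lists of different lengths
-- apart.
ListRule : List Tree → Tree → Tree → Set
ListRule E s t =
  (s ≡ nil × t ≡ nil)
  ⊎ (¬ s ≡ nil × ¬ t ≡ nil × termPair (head s) (head t) ∈ E × listPair (tail s) (tail t) ∈ E)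

Rule : List Tree → List Tree → List Tree → Tree → Set
Rule Γ N E u =
  (head u ≡ nil × TermRule Γ N E (head (tail u)) (tail (tail u)))
  ⊎ (head u ≡ true × ListRule E (head (tail u)) (tail (tail u)))

Rule-mono : ∀ {Γ N E E′ u} → E ⊆ E′ → Rule Γ N E u → Rule Γ N E′ u
Rule-mono E⊆ (inj₁ (tag , inj₁ st∈))                  = inj₁ (tag , inj₁ st∈)
Rule-mono E⊆ (inj₁ (tag , inj₂ (inj₁ (h , st∈))))     = inj₁ (tag , inj₂ (inj₁ (h , E⊆ st∈)))
Rule-mono E⊆ (inj₁ (tag , inj₂ (inj₂ (u , u∈ , us , ut)))) = inj₁ (tag , inj₂ (inj₂ (u , u∈ , E⊆ us , E⊆ ut)))
Rule-mono E⊆ (inj₂ (tag , inj₁ nils))                 = inj₂ (tag , inj₁ nils)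
Rule-mono E⊆ (inj₂ (tag , inj₂ (s≢ , t≢ , h , l)))    = inj₂ (tag , inj₂ (s≢ , t≢ , E⊆ h , E⊆ l))

termPairᵖ : ∀ {f g} → PolyTime f → PolyTime g → PolyTime (λ x → termPair (f x) (g x))
termPairᵖ F G = nilᵖ ∙ᵖ (F ∙ᵖ G)

listPairᵖ : ∀ {f g} → PolyTime f → PolyTime g → PolyTime (λ x → listPair (f x) (g x))
listPairᵖ F G = constᵖ true ∙ᵖ (F ∙ᵖ G)

module _ {E s t : Tree → Tree} (Eᵖ : PolyTime E) (sᵖ : PolyTime s) (tᵖ : PolyTime t) where

  TermRuleᵈ : ∀ {Γ N} → PolyTime Γ → PolyTime N →
              PolyDec (λ x → TermRule (items (Γ x)) (items (N x)) (items (E x)) (s x) (t x))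
  TermRuleᵈ Γᵖ Nᵖ =
    (sᵖ ∙ᵖ tᵖ) ∈ᵈ Γᵖ
    ⊎ᵈ (headᵖ sᵖ ≡ᵈ headᵖ tᵖ) ×ᵈ listPairᵖ (tailᵖ sᵖ) (tailᵖ tᵖ) ∈ᵈ Eᵖ
    ⊎ᵈ ∃ᵈ (termPairᵖ (tailᵖ idᵖ) (headᵖ (tailᵖ (headᵖ idᵖ))) ∈ᵈ headᵖ (headᵖ idᵖ)
            ×ᵈ termPairᵖ (tailᵖ idᵖ) (tailᵖ (tailᵖ (headᵖ idᵖ))) ∈ᵈ headᵖ (headᵖ idᵖ))
          (Eᵖ ∙ᵖ (sᵖ ∙ᵖ tᵖ)) Nᵖ

  ListRuleᵈ : PolyDec (λ x → ListRule (items (E x)) (s x) (t x))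
  ListRuleᵈ =
    (sᵖ ≡ᵈ nilᵖ) ×ᵈ (tᵖ ≡ᵈ nilᵖ)
    ⊎ᵈ (¬ᵈ (sᵖ ≡ᵈ nilᵖ)) ×ᵈ (¬ᵈ (tᵖ ≡ᵈ nilᵖ))
       ×ᵈ termPairᵖ (headᵖ sᵖ) (headᵖ tᵖ) ∈ᵈ Eᵖ
       ×ᵈ listPairᵖ (tailᵖ sᵖ) (tailᵖ tᵖ) ∈ᵈ Eᵖ

Ruleᵈ : PolyDec (λ y → Rule (items (head (head (head y)))) (items (tail (head (head y))))
                            (items (tail (head y))) (tail y))
Ruleᵈ =
  (headᵖ (tailᵖ idᵖ) ≡ᵈ nilᵖ) ×ᵈ TermRuleᵈ Eᵖ sᵖ tᵖ (headᵖ (headᵖ (headᵖ idᵖ))) (tailᵖ (headᵖ (headᵖ idᵖ)))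
  ⊎ᵈ (headᵖ (tailᵖ idᵖ) ≡ᵈ constᵖ true) ×ᵈ ListRuleᵈ Eᵖ sᵖ tᵖ
  where
  Eᵖ = tailᵖ (headᵖ idᵖ)
  sᵖ = headᵖ (tailᵖ (tailᵖ idᵖ))
  tᵖ = tailᵖ (tailᵖ (tailᵖ idᵖ))

addPair addPairs : Tree → Tree
addPair y  = termPair (head (head y)) (tail (head y)) ∙ (listPair (head (head y)) (tail (head y)) ∙ tail y)
addPairs y = fold addPair (tail (head y)) (tail y) (head (head y))

-- Two nested folds: the parameter of the outer one is the list `N`, that of the inner one the left
-- component.
allPairs : Tree → Tree
allPairs N = fold addPairs N nil N

private
  pairGrowth : Polynomial
  pairGrowth = const 8 ⊕ (X ⊕ X)

  addPairᵖ : PolyTime addPair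
  addPairᵖ = termPairᵖ (headᵖ (headᵖ idᵖ)) (tailᵖ (headᵖ idᵖ))
             ∙ᵖ (listPairᵖ (headᵖ (headᵖ idᵖ)) (tailᵖ (headᵖ idᵖ)) ∙ᵖ tailᵖ idᵖ)

  addPair-grows : ∀ s t a → size (addPair ((s ∙ t) ∙ a)) ≤ eval pairGrowth (size (s ∙ t)) + size a
  addPair-grows s t a = ≤-reflexive (begin
    3 + (n + (5 + (n + size a)))    ≡⟨ ≡.cong (3 +_) (≡.sym (+-assoc n 5 _)) ⟩
    3 + (n + 5 + (n + size a))      ≡⟨ ≡.cong (λ m → 3 + (m + (n + size a))) (+-comm n 5) ⟩
    8 + (n + (n + size a))          ≡⟨ ≡.cong (8 +_) (≡.sym (+-assoc n n _)) ⟩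
    8 + (n + n + size a)            ∎)
    where
    open ≡.≡-Reasoning
    n : ℕ
    n = size (s ∙ t)

  addPairsᵖ : PolyTime addPairs
  addPairsᵖ = foldᵖ addPairᵖ pairGrowth addPair-grows (tailᵖ (headᵖ idᵖ)) (tailᵖ idᵖ) (headᵖ (headᵖ idᵖ))

  addPairs-grows : ∀ N s a → size (addPairs ((N ∙ s) ∙ a)) ≤ eval (X ⊗ pairGrowth) (size (N ∙ s)) + size a
  addPairs-grows N s a = ≤-trans (size-fold addPairᵖ pairGrowth addPair-grows s a N)
    (+-monoˡ-≤ (size a) (*-mono-≤ (size-head (N ∙ s))
      (eval-mono pairGrowth (≤-reflexive (≡.cong suc (+-comm (size s) (size N)))))))

allPairsᵖ : ∀ {f} → PolyTime f → PolyTime (λ x → allPairs (f x))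
allPairsᵖ F = foldᵖ addPairsᵖ (X ⊗ pairGrowth) addPairs-grows F nilᵖ F

module _ (N : Tree) {s t : Tree} (s∈ : s ∈ items N) (t∈ : t ∈ items N) where

  private
    addPair-⊇ : ∀ s l {a} → items a ⊆ items (fold addPair s a l)
    addPair-⊇ s nil     = id
    addPair-⊇ s (e ∙ l) = λ x∈ → there (there (addPair-⊇ s l x∈))

    addPair-∈ : ∀ l {a} → t ∈ items l → termPair s t ∈ items (fold addPair s a l)
                                      × listPair s t ∈ items (fold addPair s a l)
    addPair-∈ (e ∙ l) (here refl) = here refl , there (here refl)
    addPair-∈ (e ∙ l) (there t∈)  = let a , b = addPair-∈ l t∈ in there (there a) , there (there b)

    addPairs-∈ : ∀ l → s ∈ items l → termPair s t ∈ items (fold addPairs N nil l)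
                                   × listPair s t ∈ items (fold addPairs N nil l)
    addPairs-∈ (e ∙ l) (here refl) = addPair-∈ N t∈
    addPairs-∈ (e ∙ l) (there s∈)  =
      let a , b = addPairs-∈ l s∈ in addPair-⊇ e N a , addPair-⊇ e N b

  allPairs-∈ : termPair s t ∈ items (allPairs N) × listPair s t ∈ items (allPairs N)
  allPairs-∈ = addPairs-∈ N s∈

-- The obstruction to entering `F`, phrased as a bounded search; `items (tail s′)` are the encoded
-- arguments of `s′`. Its negation is monotone in `F`, as a least fixed point requires.
Escapes : List Tree → List Tree → List Tree → Tree → Set
Escapes E N F s = ∃[ s′ ] s′ ∈ N × termPair s s′ ∈ E × ∃[ e ] e ∈ items (tail s′) × ¬ e ∈ F

Escapes-mono : ∀ {E N F F′ s} → F ⊆ F′ → Escapes E N F′ s → Escapes E N F s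
Escapes-mono F⊆ (s′ , s′∈ , ss′ , e , e∈ , e∉) = s′ , s′∈ , ss′ , e , e∈ , e∉ ∘ F⊆

Escapesᵈ : PolyDec (λ y → Escapes (items (head (head (head y)))) (items (tail (head (head y))))
                                  (items (tail (head y))) (tail y))
Escapesᵈ =
  ∃ᵈ (termPairᵖ (tailᵖ (headᵖ idᵖ)) (tailᵖ idᵖ) ∈ᵈ headᵖ (headᵖ (headᵖ (headᵖ idᵖ)))
       ×ᵈ ∃ᵈ (¬ᵈ (tailᵖ idᵖ ∈ᵈ headᵖ idᵖ)) (tailᵖ (headᵖ (headᵖ idᵖ))) (tailᵖ (tailᵖ idᵖ)))
     idᵖ (tailᵖ (headᵖ (headᵖ idᵖ)))

items-closed : ∀ {N : List Tree} → SubtreeClosed N → ∀ t → t ∈ N → items t ⊆ N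
items-closed closed (u ∙ v) uv∈ (here refl) = proj₁ (closed uv∈)
items-closed closed (u ∙ v) uv∈ (there e∈)  = items-closed closed v (proj₂ (closed uv∈)) e∈

-- Encodings

module _ {S : Signature} where
  open Signature S

  unary-injective : ∀ {m n} → unary {S} m ≡ unary {S} n → m ≡ n
  unary-injective {zero}  {zero}  _  = refl
  unary-injective {suc m} {suc n} eq = ≡.cong suc (unary-injective (≡.cong tail eq))

  encodeTerm-injective : ∀ {p q : Term S} → encodeTerm p ≡ encodeTerm q → p ≡ q
  encodeTerms-injective : ∀ {n} {ps qs : Vec (Term S) n} → encodeTerms ps ≡ encodeTerms qs → ps ≡ qs
  encodeTerm-injective {con c} {con d} eq =
    ≡.cong con (Fin.toℕ-injective (unary-injective (≡.cong (tail ∘ head) eq)))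
  encodeTerm-injective {con c} {app g us} eq with () ← ≡.cong (head ∘ head) eq
  encodeTerm-injective {app f ts} {con d} eq with () ← ≡.cong (head ∘ head) eq
  encodeTerm-injective {app f ts} {app g us} eq
    with Fin.toℕ-injective {i = f} {j = g} (unary-injective (≡.cong (tail ∘ head) eq))
  ... | refl = ≡.cong (app f) (encodeTerms-injective (≡.cong tail eq))
  encodeTerms-injective {ps = []}     {[]}     _  = refl
  encodeTerms-injective {ps = p ∷ ps} {q ∷ qs} eq =
    cong₂ _∷_ (encodeTerm-injective (≡.cong head eq)) (encodeTerms-injective (≡.cong tail eq))

  ∈-encode⁺ : ∀ {Γ : Equations S} {p q} → (p , q) ∈ Γ → encodeTerm p ∙ encodeTerm q ∈ items (encode Γ)
  ∈-encode⁺ (here refl) = here refl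
  ∈-encode⁺ (there pq∈) = there (∈-encode⁺ pq∈)

  ∈-encode⁻ : ∀ (Γ : Equations S) {s t} → s ∙ t ∈ items (encode Γ) →
              ∃[ p ] ∃[ q ] (p , q) ∈ Γ × s ≡ encodeTerm p × t ≡ encodeTerm q
  ∈-encode⁻ ((p , q) ∷ Γ) (here refl) = p , q , here refl , refl , refl
  ∈-encode⁻ (_ ∷ Γ)       (there st∈) =
    let p , q , pq∈ , s≡p , t≡q = ∈-encode⁻ Γ st∈ in p , q , there pq∈ , s≡p , t≡q

  ∈-encodeTerms⁻ : ∀ {n} (ts : Vec (Term S) n) {e} → e ∈ items (encodeTerms ts) →
                   ∃[ i ] e ≡ encodeTerm (Vec.lookup ts i)
  ∈-encodeTerms⁻ (t ∷ ts) (here refl) = zero , refl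
  ∈-encodeTerms⁻ (t ∷ ts) (there e∈)  = let i , e≡ = ∈-encodeTerms⁻ ts e∈ in suc i , e≡

  encodeTerms-All : ∀ {n} {N : List Tree} → SubtreeClosed N → (ts : Vec (Term S) n) →
                    encodeTerms ts ∈ N → All (λ t → encodeTerm t ∈ N) ts
  encodeTerms-All closed []       _   = []
  encodeTerms-All closed (t ∷ ts) ts∈ = let a , b = closed ts∈ in a ∷ encodeTerms-All closed ts b

-- The algorithm

module _ (S : Signature) where
  open Signature S

  constants : Tree
  constants = fromList (map (λ c → encodeTerm {S} (con c)) (allFin _))

  opaque

    -- The constants are adjoined so that each of them occurs even if the equations do not mention
    -- it.
    universe : Tree → Tree
    universe x = subtrees (x ∙ constants) nil

    universeᵖ : PolyTime universe
    universeᵖ = subtreesᵖ (idᵖ ∙ᵖ constᵖ constants)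

    universe-closed : ∀ x → SubtreeClosed (items (universe x))
    universe-closed x = subtrees-closed (x ∙ constants) {nil} λ ()

    universe-root : ∀ x → x ∙ constants ∈ items (universe x)
    universe-root x = subtrees-root (x ∙ constants) {nil}

    congruent : Tree → Tree
    congruent x = limit Ruleᵈ (x ∙ universe x) (allPairs (universe x))

    congruentᵖ : PolyTime congruent
    congruentᵖ = limitᵖ Ruleᵈ (idᵖ ∙ᵖ universeᵖ) (allPairsᵖ universeᵖ)

    finiteClasses : Tree → Tree
    finiteClasses x = limit (¬ᵈ Escapesᵈ) (congruent x ∙ universe x) (universe x)

    finiteClassesᵖ : PolyTime finiteClasses
    finiteClassesᵖ = limitᵖ (¬ᵈ Escapesᵈ) (congruentᵖ ∙ᵖ universeᵖ) universeᵖ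

  NoFiniteConstant : Tree → Set
  NoFiniteConstant x = ¬ (∃[ c ] c ∈ items constants × c ∈ items (finiteClasses x))

  NoFiniteConstantᵈ : PolyDec NoFiniteConstant
  NoFiniteConstantᵈ = ¬ᵈ (∃ᵈ (tailᵖ idᵖ ∈ᵈ headᵖ idᵖ) finiteClassesᵖ (constᵖ constants))

-- Soundness of the computed congruence closure.

module Correctness {S : Signature} (Γ : Equations S) where
  open Signature S

  N E F : Tree
  N = universe S (encode Γ)
  E = congruent S (encode Γ)
  F = finiteClasses S (encode Γ)

  -- Subtrees that encode no term may occur in E as well, hence the formulation.
  _⇝_ _⇝*_ : Tree → Tree → Set
  s ⇝ t  = ∀ p → s ≡ encodeTerm p → ∃[ q ] t ≡ encodeTerm q × Γ ⊢ p ∼ q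
  s ⇝* t = ∀ {n} (ps : Vec (Term S) n) → s ≡ encodeTerms ps →
           ∃[ qs ] t ≡ encodeTerms {n = n} qs × Pointwise (Γ ⊢_∼_) ps qs

  -- Both directions are kept because the Euclidean rule reads one premise backwards.
  Sound : Tree → Set
  Sound u = (head u ≡ nil → left ⇝ right × right ⇝ left)
          × (head u ≡ true → left ⇝* right × right ⇝* left)
    where
    left right : Tree
    left  = head (tail u)
    right = tail (tail u)

  ⇝-trans : ∀ {s t u} → s ⇝ t → t ⇝ u → s ⇝ u
  ⇝-trans s⇝t t⇝u p s≡p =
    let q , t≡q , p∼q = s⇝t p s≡p
        r , u≡r , q∼r = t⇝u q t≡q
    in  r , u≡r , trans p∼q q∼r

  ⇝-cong : ∀ {s t} → head s ≡ head t → tail s ⇝* tail t → s ⇝ t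
  ⇝-cong {t = nil}   () _ (con c)    refl
  ⇝-cong {t = nil}   () _ (app f ts) refl
  ⇝-cong {t = _ ∙ _} refl tails (con c) refl with tails [] refl
  ... | [] , refl , [] = con c , refl , refl
  ⇝-cong {t = _ ∙ _} refl tails (app f ts) refl with tails ts refl
  ... | us , refl , ts∼us = app f us , refl , cong f ts∼us

  ⇝*-nil : nil ⇝* nil
  ⇝*-nil [] refl = [] , refl , []

  ⇝*-cons : ∀ {s t} → ¬ s ≡ nil → ¬ t ≡ nil → head s ⇝ head t → tail s ⇝* tail t → s ⇝* t
  ⇝*-cons s≢nil _ _ _ [] s≡nil = ⊥-elim (s≢nil s≡nil)
  ⇝*-cons {t = nil} _ t≢nil _ _ (p ∷ ps) _ = ⊥-elim (t≢nil refl)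
  ⇝*-cons {t = _ ∙ _} _ _ heads tails (p ∷ ps) refl with heads p refl | tails ps refl
  ... | q , refl , p∼q | qs , refl , ps∼qs = q ∷ qs , refl , p∼q ∷ ps∼qs

  axiom-sound : ∀ {s t} → s ∙ t ∈ items (encode Γ) → s ⇝ t × t ⇝ s
  axiom-sound st∈ with ∈-encode⁻ Γ st∈
  ... | p , q , pq∈ , refl , refl =
    (λ p′ p≡p′ → q , refl , subst (Γ ⊢_∼ q) (encodeTerm-injective p≡p′) (axiom pq∈)) ,
    (λ q′ q≡q′ → p , refl , subst (Γ ⊢_∼ p) (encodeTerm-injective q≡q′) (sym (axiom pq∈)))

  TermRule-sound : ∀ {E s t} → (∀ {e} → e ∈ items E → Sound e) →
                   TermRule (items (encode Γ)) (items N) (items E) s t → s ⇝ t × t ⇝ s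
  TermRule-sound E-sound (inj₁ st∈) = axiom-sound st∈
  TermRule-sound E-sound (inj₂ (inj₁ (heads , tails))) =
    let s⇝t , t⇝s = proj₂ (E-sound tails) refl
    in  ⇝-cong heads s⇝t , ⇝-cong (≡.sym heads) t⇝s
  TermRule-sound E-sound (inj₂ (inj₂ (_ , _ , rs , rt))) =
    let r⇝s , s⇝r = proj₁ (E-sound rs) refl
        r⇝t , t⇝r = proj₁ (E-sound rt) refl
    in  ⇝-trans s⇝r r⇝t , ⇝-trans t⇝r r⇝s

  ListRule-sound : ∀ {E s t} → (∀ {e} → e ∈ items E → Sound e) →
                   ListRule (items E) s t → s ⇝* t × t ⇝* s
  ListRule-sound E-sound (inj₁ (refl , refl)) = ⇝*-nil , ⇝*-nil
  ListRule-sound E-sound (inj₂ (s≢nil , t≢nil , heads , tails)) =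
    let s⇝t , t⇝s   = proj₁ (E-sound heads) refl
        s⇝*t , t⇝*s = proj₂ (E-sound tails) refl
    in  ⇝*-cons s≢nil t≢nil s⇝t s⇝*t , ⇝*-cons t≢nil s≢nil t⇝s t⇝*s

  nil≢true : ∀ {u} → u ≡ nil → ¬ u ≡ true
  nil≢true refl ()

  Rule-sound : ∀ {E} u → (∀ {e} → e ∈ items E → Sound e) →
               Rule (items (encode Γ)) (items N) (items E) u → Sound u
  Rule-sound {E} u E-sound (inj₁ (u≡nil , rule))  =
    (λ _ → TermRule-sound {E} E-sound rule) , λ u≡true → ⊥-elim (nil≢true u≡nil u≡true)
  Rule-sound {E} u E-sound (inj₂ (u≡true , rule)) =
    (λ u≡nil → ⊥-elim (nil≢true u≡nil u≡true)) , λ _ → ListRule-sound {E} E-sound rule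

  opaque
    unfolding congruent

    E-sound : ∀ {u} → u ∈ items E → Sound u
    E-sound = limit-induction Ruleᵈ (λ _ → Sound) (λ {_} {E} {u} E-sound _ → Rule-sound {E} u E-sound)

    E-closed : ∀ {u} → u ∈ items (allPairs N) →
               Rule (items (encode Γ)) (items N) (items E) u → u ∈ items E
    E-closed = limit-closed Ruleᵈ (λ {_} {_} {u} → Rule-mono {u = u})

  -- Completeness of the closure on occurring terms.

  N-closed : SubtreeClosed (items N)
  N-closed = universe-closed S (encode Γ)

  encode∈N : encode Γ ∈ items N × constants S ∈ items N
  encode∈N = N-closed (universe-root S (encode Γ))

  Occurs : Term S → Set
  Occurs t = encodeTerm t ∈ items N

  Occurs-axiom : ∀ {p q} → (p , q) ∈ Γ → Occurs p × Occurs q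
  Occurs-axiom pq∈ = N-closed (items-closed N-closed (encode Γ) (proj₁ encode∈N) (∈-encode⁺ pq∈))

  Occurs-V : ∀ {p} → p ∈V Γ → Occurs p
  Occurs-V (_ , inj₁ pq∈) = proj₁ (Occurs-axiom pq∈)
  Occurs-V (_ , inj₂ qp∈) = proj₂ (Occurs-axiom qp∈)

  Occurs-args : ∀ {f ts} → Occurs (app f ts) → All Occurs ts
  Occurs-args {f} {ts} t∈ = encodeTerms-All N-closed ts (proj₂ (N-closed t∈))

  constants⁺ : ∀ c → encodeTerm {S} (con c) ∈ items (constants S)
  constants⁺ c = subst (encodeTerm {S} (con c) ∈_) (≡.sym (items-fromList _))
    (∈-map⁺ (λ c → encodeTerm {S} (con c)) (∈-allFin c))

  Occurs-con : ∀ c → Occurs (con c)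
  Occurs-con c = items-closed N-closed (constants S) (proj₂ encode∈N) (constants⁺ c)

  _E∋_ : Term S → Term S → Set
  p E∋ q = termPair (encodeTerm p) (encodeTerm q) ∈ items E

  term-rule : ∀ {s t} → s ∈ items N → t ∈ items N →
              TermRule (items (encode Γ)) (items N) (items E) s t → termPair s t ∈ items E
  term-rule s∈ t∈ rule = E-closed (proj₁ (allPairs-∈ N s∈ t∈)) (inj₁ (refl , rule))

  list-rule : ∀ {s t} → s ∈ items N → t ∈ items N → ListRule (items E) s t → listPair s t ∈ items E
  list-rule s∈ t∈ rule = E-closed (proj₂ (allPairs-∈ N s∈ t∈)) (inj₂ (refl , rule))

  E-args : ∀ {n} {ps qs : Vec (Term S) n} → encodeTerms ps ∈ items N → encodeTerms qs ∈ items N →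
           Pointwise _E∋_ ps qs → listPair (encodeTerms ps) (encodeTerms qs) ∈ items E
  E-args ps∈ qs∈ []          = list-rule ps∈ qs∈ (inj₁ (refl , refl))
  E-args ps∈ qs∈ (pq ∷ psqs) = list-rule ps∈ qs∈ (inj₂ ((λ ()) , (λ ()) , pq ,
    E-args (proj₂ (N-closed ps∈)) (proj₂ (N-closed qs∈)) psqs))

  E-axiom : ∀ {p q} → (p , q) ∈ Γ → p E∋ q
  E-axiom pq∈ = let p∈ , q∈ = Occurs-axiom pq∈ in term-rule p∈ q∈ (inj₁ (∈-encode⁺ pq∈))

  E-euclid : ∀ {p q r} → Occurs p → Occurs q → Occurs r → p E∋ q → p E∋ r → q E∋ r
  E-euclid p∈ q∈ r∈ pq pr = term-rule q∈ r∈ (inj₂ (inj₂ (_ , p∈ , pq , pr)))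

  E-con : ∀ {c} → Occurs (con c) → con c E∋ con c
  E-con c∈ = term-rule c∈ c∈ (inj₂ (inj₁ (refl ,
    E-args {ps = []} {[]} (proj₂ (N-closed c∈)) (proj₂ (N-closed c∈)) [])))

  E-app : ∀ {f ps qs} → Occurs (app f ps) → Occurs (app f qs) → Pointwise _E∋_ ps qs → app f ps E∋ app f qs
  E-app p∈ q∈ psqs = term-rule p∈ q∈ (inj₂ (inj₁ (refl ,
    E-args (proj₂ (N-closed p∈)) (proj₂ (N-closed q∈)) psqs)))

  open Extension Γ Occurs _E∋_ Occurs-args Occurs-axiom E-axiom E-euclid E-con E-app using (∼⇒E)

  -- Membership in `F` and bounded depth.

  open DecMembership _≟ᵗ_ using (_∈?_)

  -- A passage at the root goes through `V`, whose members occur in the equations. Hence a possibly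
  -- infinite class has only finitely many shapes at the root.
  ∼-occurring : ∀ {p t} → Occurs p → Γ ⊢ t ∼ p → ∃[ q ] Occurs q × Γ ⊢ p ∼ q × _≈ʳ_ Γ t q
  ∼-occurring p∈ t∼p with ∼⇒≈ʳ⊎≈ᵛ Γ t∼p
  ... | inj₁ t≈p                       = _ , p∈ , refl , t≈p
  ... | inj₂ (viaV q∈V _ t≈q q∼r r≈p) = _ , Occurs-V q∈V , sym (trans q∼r (≈ʳ⇒∼ Γ r≈p)) , t≈q

  DepthBounded : ℕ → Tree → Set
  DepthBounded k s = ∀ p → s ≡ encodeTerm p → ∀ {t} → Γ ⊢ t ∼ p → depth t ≤ k

  args-bounded : ∀ {k n} {ts ps : Vec (Term S) n} → Pointwise (Γ ⊢_∼_) ts ps →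
                 (∀ {e} → e ∈ items (encodeTerms ps) → DepthBounded k e) → depths ts ≤ k
  args-bounded []            _       = z≤n
  args-bounded (t∼p ∷ ts∼ps) bounded =
    ⊔-lub (bounded (here refl) _ refl t∼p) (args-bounded ts∼ps (bounded ∘ there))

  -- A term congruent to `p` agrees at the root with an occurring `q` that `E` relates to `p`. The
  -- arguments of `q` are in `G`, so those of the term have depth at most `k`.
  ¬Escapes⇒DepthBounded : ∀ {k G s} → (∀ {e} → e ∈ items G → DepthBounded k e) → s ∈ items N →
                          ¬ Escapes (items E) (items N) (items G) s → DepthBounded (suc k) s
  ¬Escapes⇒DepthBounded bounded s∈ ¬escapes p refl t∼p with ∼-occurring s∈ t∼p
  ... | _ , q∈ , p∼q , con = z≤n
  ... | _ , q∈ , p∼q , app ts∼us =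
    -- Not escaping gives membership only up to double negation, which decidability removes.
    s≤s (args-bounded ts∼us λ {e} e∈ → bounded (decidable-stable (e ∈? _)
      λ e∉ → ¬escapes (_ , q∈ , ∼⇒E s∈ q∈ p∼q , e , e∈ , e∉)))

  opaque
    unfolding finiteClasses

    F-bounded : ∀ {s} → s ∈ items F → DepthBounded (length (items N)) s
    F-bounded = limit-induction (¬ᵈ Escapesᵈ) DepthBounded ¬Escapes⇒DepthBounded

    F-closed : ∀ {s} → s ∈ items N → ¬ Escapes (items E) (items N) (items F) s → s ∈ items F
    F-closed = limit-closed (¬ᵈ Escapesᵈ) (λ F⊆ ¬escapes → ¬escapes ∘ Escapes-mono F⊆)

  ∉F⇒Escapes : ∀ {s} → s ∈ items N → ¬ s ∈ items F → Escapes (items E) (items N) (items F) s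
  ∉F⇒Escapes {s} s∈ s∉F = decidable-stable (decide Escapesᵈ (((E ∙ N) ∙ F) ∙ s)) (s∉F ∘ F-closed s∈)

  -- Outside `F` some congruent term has an argument that is again outside `F`, so the descent can
  -- be continued for any number of levels.
  ∉F⇒Unbounded : ∀ {p} → Occurs p → ¬ encodeTerm p ∈ items F → Unbounded Γ p
  ∉F⇒Unbounded {p} p∈ p∉F zero    = p , refl , z≤n
  ∉F⇒Unbounded {p} p∈ p∉F (suc k) with ∉F⇒Escapes p∈ p∉F
  ... | s , s∈ , ps , e , e∈ , e∉F with proj₁ (proj₁ (E-sound ps) refl) p refl
  -- A constant has no arguments, so the escaping term is an application.
  ...   | app f ts , refl , p∼q with ∈-encodeTerms⁻ ts e∈
  ...     | i , refl =
    Deep-∼ Γ (sym p∼q) (Deep-⊳ Γ (arg f ts i)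
      (∉F⇒Unbounded (items-closed N-closed _ (proj₂ (N-closed s∈)) e∈) e∉F k))

  NoFiniteConstant⇔IntrinsicallyInfinite : NoFiniteConstant S (encode Γ) ⇔ IntrinsicallyInfinite Γ
  NoFiniteConstant⇔IntrinsicallyInfinite = mk⇔
    (λ none → Equivalence.from (IntrinsicallyInfinite⇔Unbounded Γ)
      λ c → ∉F⇒Unbounded (Occurs-con c) (λ c∈F → none (_ , constants⁺ c , c∈F)))
    (λ { infinite (_ , c∈ , c∈F) → refute infinite c∈ c∈F })
    where
    refute : ∀ {s} → IntrinsicallyInfinite Γ → s ∈ items (constants S) → ¬ s ∈ items F
    refute infinite s∈ s∈F with ∈-map⁻ _ (subst (_ ∈_) (items-fromList _) s∈)
    ... | c , _ , refl
      with Equivalence.to (IntrinsicallyInfinite⇔Unbounded Γ) infinite c (suc (length (items N)))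
    ...   | t , t∼c , N<t = <⇒≱ N<t (F-bounded s∈F (con c) refl t∼c)

-- Size of encodings

module _ (S : Signature) where
  open Signature S

  -- The cost of one node: its symbol index `k` takes `1 + 2 * k` in unary, and 7 bounds the
  -- remaining cells.
  encodingFactor : ℕ
  encodingFactor = 8 + 2 * (#constants + #functions)

  size-unary : ∀ n → size (unary {S} n) ≡ 1 + 2 * n
  size-unary zero    = refl
  size-unary (suc n) = ≡.cong (λ m → 2 + m) (≡.trans (size-unary n) (≡.sym (+-suc n (n + 0))))

  size-unary-≤ : ∀ k → k ≤ #constants + #functions → 7 + size (unary {S} k) ≤ encodingFactor
  size-unary-≤ k k≤ = ≤-trans (+-monoʳ-≤ 7 (≤-reflexive (size-unary k))) (+-monoʳ-≤ 8 (*-monoʳ-≤ 2 k≤))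

  -- The additional `suc` pays for the cell that holds the term in an argument list or an equation.
  size-encodeTerm : ∀ t → suc (size (encodeTerm {S} t)) ≤ encodingFactor * ∣ t ∣ₜ
  size-encodeTerms : ∀ {n} (ts : Vec (Term S) n) → size (encodeTerms ts) ≤ suc (encodingFactor * ∣ ts ∣ₜ*)
  size-encodeTerm (con c) = begin
    4 + (u + 1)              ≡⟨ ≡.cong (4 +_) (+-comm u 1) ⟩
    5 + u                    ≤⟨ m≤n+m (5 + u) 2 ⟩
    7 + u                    ≤⟨ size-unary-≤ (toℕ c) (≤-trans (<⇒≤ (Fin.toℕ<n c)) (m≤m+n _ _)) ⟩
    encodingFactor           ≡⟨ ≡.sym (*-identityʳ encodingFactor) ⟩
    encodingFactor * 1       ∎
    where
    open ≤-Reasoning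
    u : ℕ
    u = size (unary {S} (toℕ c))
  size-encodeTerm (app f ts) = begin
    6 + (u + size (encodeTerms ts))              ≤⟨ +-monoʳ-≤ 6 (+-monoʳ-≤ u (size-encodeTerms ts)) ⟩
    6 + (u + suc (encodingFactor * ∣ ts ∣ₜ*))    ≡⟨ ≡.cong (6 +_) (+-suc u _) ⟩
    7 + u + encodingFactor * ∣ ts ∣ₜ*
      ≤⟨ +-monoˡ-≤ _ (size-unary-≤ (toℕ f) (≤-trans (<⇒≤ (Fin.toℕ<n f)) (m≤n+m _ #constants))) ⟩
    encodingFactor + encodingFactor * ∣ ts ∣ₜ*   ≡⟨ ≡.sym (*-suc encodingFactor ∣ ts ∣ₜ*) ⟩
    encodingFactor * suc ∣ ts ∣ₜ*                ∎
    where
    open ≤-Reasoning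
    u : ℕ
    u = size (unary {S} (toℕ f))
  size-encodeTerms []       = s≤s z≤n
  size-encodeTerms (t ∷ ts) = begin
    suc (size (encodeTerm t)) + size (encodeTerms ts)
      ≤⟨ +-mono-≤ (size-encodeTerm t) (size-encodeTerms ts) ⟩
    encodingFactor * ∣ t ∣ₜ + suc (encodingFactor * ∣ ts ∣ₜ*)                ≡⟨ +-suc _ _ ⟩
    suc (encodingFactor * ∣ t ∣ₜ + encodingFactor * ∣ ts ∣ₜ*)
      ≡⟨ ≡.cong suc (≡.sym (*-distribˡ-+ encodingFactor ∣ t ∣ₜ ∣ ts ∣ₜ*)) ⟩
    suc (encodingFactor * ∣ t ∷ ts ∣ₜ*)                                      ∎
    where open ≤-Reasoning

  size-encode : ∀ (Γ : Equations S) → size (encode Γ) ≤ 1 + encodingFactor * ∣ Γ ∣ᴱ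
  size-encode []            = s≤s z≤n
  size-encode ((p , q) ∷ Γ) = begin
    2 + (size (encodeTerm p) + size (encodeTerm q)) + size (encode Γ)
      ≡⟨ ≡.cong (λ n → suc n + size (encode Γ)) (≡.sym (+-suc _ _)) ⟩
    suc (size (encodeTerm p)) + suc (size (encodeTerm q)) + size (encode Γ)
      ≤⟨ +-mono-≤ (+-mono-≤ (size-encodeTerm p) (size-encodeTerm q)) (size-encode Γ) ⟩
    K * ∣ p ∣ₜ + K * ∣ q ∣ₜ + suc (K * ∣ Γ ∣ᴱ)                               ≡⟨ +-suc _ _ ⟩
    suc (K * ∣ p ∣ₜ + K * ∣ q ∣ₜ + K * ∣ Γ ∣ᴱ)
      ≡⟨ ≡.cong (λ n → suc (n + K * ∣ Γ ∣ᴱ)) (≡.sym (*-distribˡ-+ K ∣ p ∣ₜ ∣ q ∣ₜ)) ⟩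
    suc (K * (∣ p ∣ₜ + ∣ q ∣ₜ) + K * ∣ Γ ∣ᴱ)
      ≡⟨ ≡.cong suc (≡.sym (*-distribˡ-+ K (∣ p ∣ₜ + ∣ q ∣ₜ) ∣ Γ ∣ᴱ)) ⟩
    suc (K * ∣ (p , q) ∷ Γ ∣ᴱ)                                               ∎
    where
    open ≤-Reasoning
    K : ℕ
    K = encodingFactor

-- Transfer of decision procedures on trees to encoded instances.

PolyDec⇒PolynomialTimeDecidable :
  ∀ {A : Set} {encode : A → Tree} {size′ : A → ℕ} {Q : Tree → Set} {R : A → Set} (bound : Polynomial) →
  (∀ a → size (encode a) ≤ eval bound (size′ a)) → (∀ a → Q (encode a) ⇔ R a) →
  PolyDec Q → PolynomialTimeDecidable encode size′ R
PolyDec⇒PolynomialTimeDecidable {encode = encode} {size′} bound encode≤ Q⇔R d =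
  let c , k , time≤ = eval-≤ (time (testᵖ d) ∘ₚ bound)
  in  program (testᵖ d) , c , k , λ a →
      let n , test⇓ , n≤ = runs (testᵖ d) (encode a)
      in  test d (encode a) , n , test⇓ ,
          ≤-trans n≤ (≤-trans (eval-mono (time (testᵖ d)) (encode≤ a))
            (≤-trans (≤-reflexive (≡.sym (eval-∘ₚ (time (testᵖ d)) bound _)))
              (≤-trans (time≤ (size′ a)) (≤-reflexive (≡.trans (*-suc c _) (+-comm c _)))))) ,
          accepts (correct d (encode a)) (Q⇔R a)
  where
  accepts : ∀ {t Q R} → t Decides Q → Q ⇔ R → t ≢ nil ⇔ R
  accepts (accept q) Q⇔R = mk⇔ (λ _ → Equivalence.to Q⇔R q) (λ _ ())
  accepts (reject ¬q) Q⇔R = mk⇔ (λ nil≢nil → ⊥-elim (nil≢nil refl)) (λ r → ⊥-elim (¬q (Equivalence.from Q⇔R r)))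

corollary3p9 : (S : Signature) →
    ((Γ : Equations S) →
    IntrinsicallyInfinite Γ ⇔ ((c : Fin (Signature.#constants S)) → HasCyclicType Γ (con c)))
    × PolynomialTimeDecidable encode ∣_∣ᴱ (IntrinsicallyInfinite {S})
corollary3p9 S =
  IntrinsicallyInfinite⇔HasCyclicType ,
  PolyDec⇒PolynomialTimeDecidable (const 1 ⊕ (const (encodingFactor S) ⊗ X)) (size-encode S)
    (λ Γ → Correctness.NoFiniteConstant⇔IntrinsicallyInfinite Γ) (NoFiniteConstantᵈ S)
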